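{- Let $\mathbb{K}\in\{\mathbb{Q},\mathbb{R},\mathbb{C}\}$, let $d\ge 0$ and $a$ be integers, and put $r:=-(a+d)$ (the degree). Let $H(t)=\sum_{i=0}^\infty \gamma_i (1-t)^{i-d}$, $\gamma_i\in\mathbb{K}$, be a formal Laurent series around $t=1$ of pole order at most $d$, and stipulate $\gamma_i=0$ for $i<0$. Then $H$ satisfies the functional equation $$H(t^{ -1})=(-1)^d t^{ -a}H(t)$$ if and only if the following conditions hold. If $r$ is even, then for each $m\ge 1$: $$\sum_{i=0}^{m-1}(-1)^i\binom{m-1}{i}\gamma_{m-r+i}=0. \qquad (\mathrm{A})$$ If $r>0$ is odd, then for each $m\ge 1$: $$\sum_{i=0}^{m}(-1)^i\binom{2m+r-2}{m-i}\binom{m+i}{i}\gamma_{m+i-1}=0. \qquad (\mathrm{B})$$ If $r<0$ (of either parity), then for each $1\le m\le \lceil -r/2\rceil$: $$\sum_{i=0}^{m}\binom{m}{i}\binom{1-r}{m+i}^{ -1}\gamma_{m+i-1}=0, \qquad (\mathrm{C})$$ and moreover, if $r<0$ is odd, then for each $m\ge1$: $$\sum_{i=0}^{m}(-1)^i\binom{m}{i}\frac{m+i}{m}\gamma_{m-r+i}=0. \qquad (\mathrm{D})$$ (Thus for $r<0$ even the conditions are (A) for all $m\ge1$ together with (C); for $r<0$ odd they are (C) together with (D).)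
   Context: The functional equation is understood as an identity of formal Laurent series in $u=1-t$: one substitutes $t=1-u$, $t^{ -1}=\sum_{j\ge0}u^j$, $1-t^{ -1}=-u/(1-u)$, so that $H(t^{ -1})=\sum_i\gamma_i\left(-u/(1-u)\right)^{i-d}$, and $t^{ -a}=(1-u)^{ -a}$ is expanded as a power series in $u$. -}

module Defs where

open import Algebra.Apartness.Bundles using (HeytingField; HeytingCommutativeRing)
open import Algebra.Bundles using (CommutativeRing; Semiring)
import Algebra.Definitions.RawMonoid as RawMonoidDefs
import Algebra.Definitions.RawSemiring as RawSemiringDefs
import Algebra.Properties.Monoid.Sum as MonoidSum
open import Data.Fin.Base using (toℕ)
open import Data.Integer.Base as ℤ using (ℤ; +_; -[1+_])
open import Data.Nat.Base as ℕ using (ℕ; zero; suc; _∸_; _≥_)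
open import Data.Nat.Combinatorics using (_C_)
open import Data.Product.Base using (∃-syntax; proj₁)
open import Level using (Level)

private
  variable
    c ℓ ℓ₁ ℓ₂ : Level

scalarRing : HeytingField c ℓ₁ ℓ₂ → CommutativeRing c ℓ₁
scalarRing K = HeytingCommutativeRing.commutativeRing (HeytingField.heytingCommutativeRing K)

CharacteristicZero : HeytingField c ℓ₁ ℓ₂ → Set ℓ₂
CharacteristicZero K = ∀ n → (suc n · 1#) # 0#
  where
  open HeytingField K using (_#_; 0#; 1#)
  open RawMonoidDefs (CommutativeRing.+-rawMonoid (scalarRing K)) renaming (_×_ to _·_)

module LaurentSeries (R : CommutativeRing c ℓ) where
  open CommutativeRing R
  open MonoidSum +-monoid using (sum-syntax; sum⁺-syntax)
  open RawSemiringDefs (Semiring.rawSemiring semiring) using (_^_)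

  -- A sequence x₀, x₁, … extended by xₖ = 0 for k < 0.
  extend : (ℕ → Carrier) → ℤ → Carrier
  extend x (+ n)    = x n
  extend x -[1+ n ] = 0#

  infix 5 u^-_∙_

  -- u^- p ∙ x  is the Laurent series  Σₙ xₙ uⁿ⁻ᵖ  in the variable u = 1 - t.
  -- The representation is not unique; series are compared through coeff.
  record Laurent : Set c where
    constructor u^-_∙_
    field
      pole : ℕ
      body : ℕ → Carrier

  open Laurent

  coeff : Laurent → ℤ → Carrier
  coeff f k = extend (body f) (k ℤ.+ + pole f)

  infixl 7 _*ᴸ_ _•_
  infix  8 -ᴸ_

  _*ᴸ_ : Laurent → Laurent → Laurent
  f *ᴸ g = u^- (pole f ℕ.+ pole g) ∙
    λ n → ∑[ i ≤ n ] (body f (toℕ i) * body g (n ∸ toℕ i))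

  _•_ : Carrier → Laurent → Laurent
  x • f = u^- pole f ∙ λ n → x * body f n

  -ᴸ_ : Laurent → Laurent
  -ᴸ f = u^- pole f ∙ λ n → - body f n

  one : Laurent
  one = u^- 0 ∙ λ { zero → 1# ; (suc _) → 0# }

  u u⁻¹ : Laurent
  u   = u^- 0 ∙ λ { 1 → 1# ; _ → 0# }
  u⁻¹ = u^- 1 ∙ body one

  t t⁻¹ : Laurent
  t   = u^- 0 ∙ λ { 0 → 1# ; 1 → - 1# ; _ → 0# }
  t⁻¹ = u^- 0 ∙ λ _ → 1#

  -- w = 1 - t⁻¹ = -u/(1-u)  and its inverse  -(1-u)/u.
  w w⁻¹ : Laurent
  w   = -ᴸ (u *ᴸ t⁻¹)
  w⁻¹ = -ᴸ (u⁻¹ *ᴸ t)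

  power : Laurent → ℕ → Laurent
  power f zero    = one
  power f (suc n) = f *ᴸ power f n

  -- Integer powers of a series f with inverse f⁻¹.
  zpower : (f f⁻¹ : Laurent) → ℤ → Laurent
  zpower f f⁻¹ (+ n)    = power f n
  zpower f f⁻¹ -[1+ n ] = power f⁻¹ (suc n)

  -- Σᵢ Fᵢ = f  as formal series: for each k, the coefficients of uᵏ in the
  -- partial sums are eventually equal to the coefficient of uᵏ in f.
  SumsTo : (ℕ → Laurent) → Laurent → Set ℓ
  SumsTo F f = ∀ k → ∃[ N ] (∀ n → n ≥ N → ∑[ i < n ] coeff (F (toℕ i)) k ≈ coeff f k)

  -- H(t⁻¹) = (-1)ᵈ t⁻ᵃ H(t)  for  H(t) = Σᵢ γᵢ (1 - t)ⁱ⁻ᵈ,  where the left-hand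
  -- side is  Σᵢ γᵢ (1 - t⁻¹)ⁱ⁻ᵈ.
  FunctionalEquation : ℕ → ℤ → (ℕ → Carrier) → Set ℓ
  FunctionalEquation d a γ =
    SumsTo (λ i → γ i • zpower w w⁻¹ (+ i ℤ.- + d))
           (((- 1#) ^ d) • (zpower t t⁻¹ (ℤ.- a) *ᴸ H))
    where
    H : Laurent
    H = u^- d ∙ γ

module Conditions (K : HeytingField c ℓ₁ ℓ₂) (char0 : CharacteristicZero K) where
  open HeytingField K using (#⇒invertible)
  open CommutativeRing (scalarRing K)
  open MonoidSum +-monoid using (sum-syntax; sum⁺-syntax)
  open RawMonoidDefs +-rawMonoid using () renaming (_×_ to _·_)
  open RawSemiringDefs (Semiring.rawSemiring semiring) using (_^_)
  open LaurentSeries (scalarRing K) using (extend)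

  -- 1/n in K, with the junk value 1/0 = 0.
  recip : ℕ → Carrier
  recip zero    = 0#
  recip (suc n) = proj₁ (#⇒invertible (char0 n))

  sign : ℕ → Carrier
  sign i = (- 1#) ^ i

  ConditionA : ℤ → (ℕ → Carrier) → ℕ → Set ℓ₁
  ConditionA r γ m =
    ∑[ i < m ] (sign (toℕ i) * (((m ∸ 1) C toℕ i) · extend γ (+ m ℤ.- r ℤ.+ + toℕ i))) ≈ 0#

  -- Meant for r > 0 and m ≥ 1, where 2m + r - 2 > 0 and the absolute value
  -- only turns it into a natural number.
  ConditionB : ℤ → (ℕ → Carrier) → ℕ → Set ℓ₁
  ConditionB r γ m =
    ∑[ i ≤ m ] (sign (toℕ i) *
      (((ℤ.∣ + (2 ℕ.* m) ℤ.+ r ℤ.- + 2 ∣ C (m ∸ toℕ i)) ℕ.* ((m ℕ.+ toℕ i) C toℕ i))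
        · extend γ (+ m ℤ.+ + toℕ i ℤ.- + 1))) ≈ 0#

  -- Meant for r < 0 and 1 ≤ m ≤ ⌈-r/2⌉, where m + i ≤ 2m ≤ 1 - r, so that every
  -- binomial coefficient inverted here is nonzero.
  ConditionC : ℤ → (ℕ → Carrier) → ℕ → Set ℓ₁
  ConditionC r γ m =
    ∑[ i ≤ m ] ((m C toℕ i) · (recip (ℤ.∣ + 1 ℤ.- r ∣ C (m ℕ.+ toℕ i))
        * extend γ (+ m ℤ.+ + toℕ i ℤ.- + 1))) ≈ 0#

  ConditionD : ℤ → (ℕ → Carrier) → ℕ → Set ℓ₁
  ConditionD r γ m =
    ∑[ i ≤ m ] (sign (toℕ i) *
      (((m C toℕ i) ℕ.* (m ℕ.+ toℕ i)) · (recip m * extend γ (+ m ℤ.- r ℤ.+ + toℕ i)))) ≈ 0#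

{-# OPTIONS --safe #-}
-- Comparing coefficients, the functional equation says that γ is fixed by the involution
--   (T γ)ₙ = Σᵢ (-1)ⁱ [uⁿ⁻ⁱ](1 - u)^(-r-i) γᵢ.
-- Up to rescaling (γₙ = [uⁿ](1 - u)^(-r) · fₙ, for r > 0 or n ≤ -r) or an index shift by r - 1, T is
-- ± the binomial transform S f n = (Δⁿ f)(0), where (Δ f)(n) = f(n) - f(n+1).  The duality
-- Δᵐ (S f) (n) = Δⁿ f (m) makes S an involution and the functionals f ↦ (Δᵐ f)(m) S-invariant, so
-- they vanish when S f = - f.  Conversely, these functionals have leading terms f(2m), while S itself
-- has leading coefficient -1 in odd degree: if they all vanish, then f + S f vanishes inductively.
-- Passing from f to the sequence n f(n-1) exchanges the two eigenspaces of S.  Up to nonzero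
-- factors (A) is (Δᵐ f)(m) = 0, and (B), (C), (D) are the same condition for n f(n-1).
module Submission where

open import Defs
open import Algebra.Apartness.Bundles using (HeytingField)
open import Algebra.Bundles using (CommutativeRing; Semiring)
import Algebra.Definitions.RawSemiring as RawSemiringDefs
import Algebra.Properties.Ring as RingProperties
import Algebra.Properties.Semiring.Mult as SemiringMult
import Algebra.Properties.Semiring.Sum as SemiringSum
import Algebra.Solver.Ring.NaturalCoefficients.Default as NatSolver
open import Data.Fin.Base using (toℕ)
open import Data.Integer.Base as ℤ using (ℤ; +_; -[1+_])
import Data.Integer.Properties as ℤ
open import Data.Nat.Base as ℕ using (ℕ; zero; suc; _∸_; _≤_; z≤n; s≤s; z<s; s<s; NonZero; _!; ⌈_/2⌉)
open import Data.Nat.Combinatorics using (_C_; nCk+nC[k+1]≡[n+1]C[k+1]; k>n⇒nCk≡0; nCn≡1; nCk≡nC[n∸k]; nCk≡n!/k![n-k]!; k![n∸k]!∣n!)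
open import Data.Nat.DivMod using (m/n*n≡m)
import Data.Nat.Properties as ℕ
open import Data.Nat.Solver using (module +-*-Solver)
open import Data.Product.Base using (∃-syntax; _,_; _×_; proj₁; proj₂)
open import Data.Sum.Base using (_⊎_; inj₁; inj₂)
open import Function.Base using (_∘_)
open import Function.Bundles using (_⇔_; mk⇔; module Equivalence)
open import Function.Construct.Composition using (_⇔-∘_)
open import Relation.Binary.PropositionalEquality as ≡ using (_≡_)
import Relation.Binary.Reasoning.Setoid as SetoidReasoning
open import Relation.Nullary.Decidable.Core using (yes; no)
open import Relation.Nullary.Negation using (¬_; contradiction)

-- The rescaling divides by [uⁿ](1 - u)^(-r). For r > 0 this is never zero, but for r ≤ 0 it
-- vanishes as soon as n > -r, so γ has to be cut there. The cut is harmless because T respects it: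
-- uⁱ(1 - u)^(-r-i) is a polynomial of degree -r when i ≤ -r, and starts at uⁱ otherwise, so neither
-- block of coefficients feeds the other. The finite low block is rescaled and yields (C); the high
-- block is shifted, and the sign (-1)^(1-r) of the shift decides between (A) and (D). A finite
-- block is also the reason why the criteria for the two eigenspaces of `S` carry a bound `N` on the
-- indices. For r > 0 the rescaled picture always asks for a fixed point of `S`, which gives (B).
-- Condition (A) comes from the other picture, in which γ is preceded by r - 1 zeros and T becomes
-- (-1)^(r-1) `S`; even r gives the sign -1. The passage from Laurent series to T avoids
-- associativity of products: multiplication by 1 - u is the injective operator `∇`, and applying it
-- raises all exponents of a family (1 - u)^sᵢ at once.

module Binomials where

  -- Identities between binomial coefficients in ℕ.

  open import Data.Nat.Base using (_+_; _*_)
  open import Data.Nat.Properties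
  open ≡ using (refl; sym; trans; cong; cong₂; subst; module ≡-Reasoning)
  open +-*-Solver
  open ≡-Reasoning

  -- A form free of division and truncated subtraction: the identities below are proved by
  -- multiplying both sides by factorials, rewriting with this equation, and cancelling.
  C-factorial : ∀ {n} a b → n ≡ a + b → (n C a) * (a ! * b !) ≡ n !
  C-factorial {n} a b refl = begin
    (n C a) * (a ! * b !)                       ≡⟨ cong (λ x → (n C a) * (a ! * x !)) (m+n∸m≡n a b) ⟨
    (n C a) * (a ! * (n ∸ a) !)                 ≡⟨ cong (_* (a ! * (n ∸ a) !)) (nCk≡n!/k![n-k]! (m≤m+n a b)) ⟩
    (n ! ℕ./ (a ! * (n ∸ a) !)) * (a ! * (n ∸ a) !) ≡⟨ m/n*n≡m (k![n∸k]!∣n! (m≤m+n a b)) ⟩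
    n !                                         ∎
    where instance _ = a !* (n ∸ a) !≢0

  C-nonZero : ∀ {n k} → k ≤ n → NonZero (n C k)
  C-nonZero {n} {k} k≤n = m*n≢0⇒m≢0 (n C k) {{subst NonZero (sym (C-factorial k (n ∸ k) (sym (m+[n∸m]≡n k≤n)))) (n !≢0)}}

  absorption : ∀ n i → suc n * (n C i) ≡ (suc n C suc i) * suc i
  absorption n i with ≤-<-connex i n
  ... | inj₂ n<i = begin
    suc n * (n C i)         ≡⟨ cong (suc n *_) (k>n⇒nCk≡0 n<i) ⟩
    suc n * 0               ≡⟨ *-zeroʳ n ⟩
    0 * suc i               ≡⟨ cong (_* suc i) (k>n⇒nCk≡0 (s<s n<i)) ⟨
    (suc n C suc i) * suc i ∎
  ... | inj₁ i≤n with k , refl ← m≤n⇒∃[o]m+o≡n i≤n = *-cancelʳ-≡ _ _ (i ! * k !) {{i !* k !≢0}} (begin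
    suc (i + k) * ((i + k) C i) * (i ! * k !)
      ≡⟨ *-assoc (suc (i + k)) ((i + k) C i) (i ! * k !) ⟩
    suc (i + k) * (((i + k) C i) * (i ! * k !))
      ≡⟨ cong (suc (i + k) *_) (C-factorial i k refl) ⟩
    suc (i + k) !
      ≡⟨ C-factorial (suc i) k refl ⟨
    ((suc i + k) C suc i) * (suc i * i ! * k !)
      ≡⟨ solve 4 (λ c s x y → c :* (s :* x :* y) := c :* s :* (x :* y)) refl ((suc i + k) C suc i) (suc i) (i !) (k !) ⟩
    ((suc i + k) C suc i) * suc i * (i ! * k !) ∎)

  module _ (x y z : ℕ) where
    private
      nested : ((x + y + z) C (x + y)) * ((x + y) C x) * (x ! * (y ! * z !)) ≡ (x + y + z) !
      nested = begin
        ((x + y + z) C (x + y)) * ((x + y) C x) * (x ! * (y ! * z !))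
          ≡⟨ solve 5 (λ a b c d e → a :* b :* (c :* (d :* e)) := a :* ((b :* (c :* d)) :* e)) refl
               ((x + y + z) C (x + y)) ((x + y) C x) (x !) (y !) (z !) ⟩
        ((x + y + z) C (x + y)) * (((x + y) C x) * (x ! * y !) * z !)
          ≡⟨ cong (λ w → ((x + y + z) C (x + y)) * (w * z !)) (C-factorial x y refl) ⟩
        ((x + y + z) C (x + y)) * ((x + y) ! * z !)
          ≡⟨ C-factorial (x + y) z refl ⟩
        (x + y + z) ! ∎

      nonZero : NonZero (x ! * (y ! * z !))
      nonZero = m*n≢0 (x !) (y ! * z !) {{x !≢0}} {{y !* z !≢0}}

    -- This and `trinomialʳ` compare factorisations of the multinomial coefficient (x+y+z)! / (x! y!
    -- z!), one for each order in which the three blocks are chosen.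
    trinomialˡ : ((x + y + z) C x) * ((y + z) C y) ≡ ((x + y + z) C (x + y)) * ((x + y) C x)
    trinomialˡ = *-cancelʳ-≡ _ _ (x ! * (y ! * z !)) {{nonZero}} (begin
      ((x + y + z) C x) * ((y + z) C y) * (x ! * (y ! * z !))
        ≡⟨ solve 4 (λ a b c d → a :* b :* (c :* d) := a :* (c :* (b :* d))) refl
             ((x + y + z) C x) ((y + z) C y) (x !) (y ! * z !) ⟩
      ((x + y + z) C x) * (x ! * (((y + z) C y) * (y ! * z !)))
        ≡⟨ cong (λ w → ((x + y + z) C x) * (x ! * w)) (C-factorial y z refl) ⟩
      ((x + y + z) C x) * (x ! * (y + z) !)
        ≡⟨ C-factorial x (y + z) (+-assoc x y z) ⟩
      (x + y + z) !
        ≡⟨ nested ⟨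
      ((x + y + z) C (x + y)) * ((x + y) C x) * (x ! * (y ! * z !)) ∎)

    trinomialʳ : ((x + y + z) C y) * ((x + z) C x) ≡ ((x + y + z) C (x + y)) * ((x + y) C x)
    trinomialʳ = *-cancelʳ-≡ _ _ (x ! * (y ! * z !)) {{nonZero}} (begin
      ((x + y + z) C y) * ((x + z) C x) * (x ! * (y ! * z !))
        ≡⟨ solve 5 (λ a b c d e → a :* b :* (c :* (d :* e)) := a :* (d :* (b :* (c :* e)))) refl
             ((x + y + z) C y) ((x + z) C x) (x !) (y !) (z !) ⟩
      ((x + y + z) C y) * (y ! * (((x + z) C x) * (x ! * z !)))
        ≡⟨ cong (λ w → ((x + y + z) C y) * (y ! * w)) (C-factorial x z refl) ⟩
      ((x + y + z) C y) * (y ! * (x + z) !)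
        ≡⟨ C-factorial y (x + z) (solve 3 (λ a b c → a :+ b :+ c := b :+ (a :+ c)) refl x y z) ⟩
      (x + y + z) !
        ≡⟨ nested ⟨
      ((x + y + z) C (x + y)) * ((x + y) C x) * (x ! * (y ! * z !)) ∎)

  -- For r = q + 1 the matrix of T has entries C(q+n, n-i) up to sign. Conjugation by the diagonal
  -- matrix C(q+n, n) turns them into C(n, i), the entries of the binomial transform.
  scaling⁺ : ∀ q {i n} → i ≤ n → ((q + n) C (n ∸ i)) * ((q + i) C i) ≡ ((q + n) C n) * (n C i)
  scaling⁺ q {i} i≤n with k , refl ← m≤n⇒∃[o]m+o≡n i≤n = begin
    ((q + (i + k)) C (i + k ∸ i)) * ((q + i) C i)
      ≡⟨ cong₂ _*_ (cong₂ _C_ (+-comm q (i + k)) (m+n∸m≡n i k)) (cong (_C i) (+-comm q i)) ⟩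
    ((i + k + q) C k) * ((i + q) C i)
      ≡⟨ trinomialʳ i k q ⟩
    ((i + k + q) C (i + k)) * ((i + k) C i)
      ≡⟨ cong (λ x → (x C (i + k)) * ((i + k) C i)) (+-comm q (i + k)) ⟨
    ((q + (i + k)) C (i + k)) * ((i + k) C i) ∎

  -- The counterpart for r = -R, with diagonal matrix C(R, n). The bound n ≤ R is the range in which
  -- that diagonal is nonzero.
  scaling⁻ : ∀ {i n R} → i ≤ n → n ≤ R → ((R ∸ i) C (n ∸ i)) * (R C i) ≡ (R C n) * (n C i)
  scaling⁻ {i} i≤n n≤R with k , refl ← m≤n⇒∃[o]m+o≡n i≤n with z , refl ← m≤n⇒∃[o]m+o≡n n≤R = begin
    ((i + k + z ∸ i) C (i + k ∸ i)) * ((i + k + z) C i)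
      ≡⟨ cong (_* ((i + k + z) C i)) (cong₂ _C_ (trans (cong (_∸ i) (+-assoc i k z)) (m+n∸m≡n i (k + z))) (m+n∸m≡n i k)) ⟩
    ((k + z) C k) * ((i + k + z) C i)
      ≡⟨ *-comm ((k + z) C k) ((i + k + z) C i) ⟩
    ((i + k + z) C i) * ((k + z) C k)
      ≡⟨ trinomialˡ i k z ⟩
    ((i + k + z) C (i + k)) * ((i + k) C i) ∎

  -- With n = m′ + i and m = m′ + 1, both sides are (2m + q - 1)! m! / (i! (m - i)!) · (n + 1).
  coefficientB : ∀ q m′ {i} → i ≤ suc m′ →
    ((suc m′ + m′ + q) C (suc m′ ∸ i)) * ((suc m′ + i) C i) * ((q + (m′ + i)) C (m′ + i)) * (q ! * (suc m′ ! * suc m′ !)) ≡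
    (suc m′ + m′ + q) ! * ((suc m′ C i) * suc (m′ + i))
  coefficientB q m′ {i} i≤m with l , i+l≡m ← m≤n⇒∃[o]m+o≡n i≤m =
    *-cancelʳ-≡ _ _ ((i ! * l !) * (n ! * (q + n) !)) {{m*n≢0 (i ! * l !) (n ! * (q + n) !) {{i !* l !≢0}} {{n !* (q + n) !≢0}}}} (begin
      x₁ * x₂ * x₃ * (q ! * (m ! * m !)) * ((i ! * l !) * (n ! * (q + n) !))
        ≡⟨ solve 9 (λ x₁ x₂ x₃ q m i l n p → x₁ :* x₂ :* x₃ :* (q :* (m :* m)) :* ((i :* l) :* (n :* p))
             := (x₁ :* (l :* p)) :* (x₂ :* (i :* m)) :* (x₃ :* (n :* q)) :* m) refl
             x₁ x₂ x₃ (q !) (m !) (i !) (l !) (n !) ((q + n) !) ⟩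
      (x₁ * (l ! * (q + n) !)) * (x₂ * (i ! * m !)) * (x₃ * (n ! * q !)) * m !
        ≡⟨ cong₂ (λ a b → a * b * (x₃ * (n ! * q !)) * m !) eq₁ (C-factorial i m (+-comm m i)) ⟩
      N ! * (suc n * n !) * (x₃ * (n ! * q !)) * m !
        ≡⟨ cong₂ (λ a b → N ! * (suc n * n !) * a * b) (C-factorial n q (+-comm q n)) (sym (C-factorial i l (sym i+l≡m))) ⟩
      N ! * (suc n * n !) * (q + n) ! * (y * (i ! * l !))
        ≡⟨ solve 6 (λ N s n p y z → N :* (s :* n) :* p :* (y :* z) := N :* (y :* s) :* (z :* (n :* p))) refl
             (N !) (suc n) (n !) ((q + n) !) y (i ! * l !) ⟩
      N ! * (y * suc n) * ((i ! * l !) * (n ! * (q + n) !)) ∎)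
    where
    m n N x₁ x₂ x₃ y : ℕ
    m = suc m′
    n = m′ + i
    N = m + m′ + q
    x₁ = N C (m ∸ i)
    x₂ = (m + i) C i
    x₃ = (q + n) C n
    y = m C i
    m∸i≡l : m ∸ i ≡ l
    m∸i≡l = trans (cong (_∸ i) (sym i+l≡m)) (m+n∸m≡n i l)
    eq₁ : x₁ * (l ! * (q + n) !) ≡ N !
    eq₁ = trans (cong (λ j → (N C j) * (l ! * (q + n) !)) m∸i≡l)
      (C-factorial l (q + n) (trans (cong (λ j → j + m′ + q) (sym i+l≡m))
        (solve 4 (λ i l m q → i :+ l :+ m :+ q := l :+ (q :+ (m :+ i))) refl i l m′ q)))

  double+ : ∀ m q → 2 * suc m + suc q ≡ 2 + (suc m + m + q)
  double+ = solve 2 (λ m q → con 2 :* (con 1 :+ m) :+ (con 1 :+ q) := con 2 :+ (con 1 :+ m :+ m :+ q)) refl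

-- Parity, and the range of (C) rewritten as 2m ≤ 1 - r.

module Parity where
  open import Data.Nat.Base using (_+_; _*_)
  open import Data.Nat.Properties
  open ≡ using (refl; sym; trans; cong; subst)

  half : ∀ n → (∃[ j ] n ≡ j + j) ⊎ (∃[ j ] n ≡ suc (j + j))
  half zero    = inj₁ (0 , refl)
  half (suc n) with half n
  ... | inj₁ (j , refl) = inj₂ (j , refl)
  ... | inj₂ (j , refl) = inj₁ (suc j , cong suc (sym (+-suc j j)))

  *2≡+ : ∀ j → j * 2 ≡ j + j
  *2≡+ j = trans (*-comm j 2) (cong (λ x → j + x) (+-identityʳ j))

  ≤⌈/2⌉⇒double≤ : ∀ m n → m ≤ ⌈ n /2⌉ → m + m ≤ suc n
  ≤⌈/2⌉⇒double≤ zero    n             _         = z≤n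
  ≤⌈/2⌉⇒double≤ (suc m) (suc zero)    (s≤s z≤n) = ≤-refl
  ≤⌈/2⌉⇒double≤ (suc m) (suc (suc n)) (s≤s m≤)  =
    s≤s (subst (_≤ suc (suc n)) (sym (+-suc m m)) (s≤s (≤⌈/2⌉⇒double≤ m n m≤)))

  double≤⇒≤⌈/2⌉ : ∀ m n → m + m ≤ suc n → m ≤ ⌈ n /2⌉
  double≤⇒≤⌈/2⌉ zero    n             _ = z≤n
  double≤⇒≤⌈/2⌉ (suc m) n             p with subst (_≤ n) (+-suc m m) (≤-pred p)
  double≤⇒≤⌈/2⌉ (suc m) (suc zero)    p | s≤s 2m≤0 = s≤s (≤-trans (m≤m+n m m) 2m≤0)
  double≤⇒≤⌈/2⌉ (suc m) (suc (suc n)) p | s≤s 2m≤n = s≤s (double≤⇒≤⌈/2⌉ m n 2m≤n)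

-- Sequences in a commutative ring: sums, differences, and powers of 1 - u.

module Sequences {c ℓ} (R : CommutativeRing c ℓ) where
  open import Data.Nat.Base using (_<_)
  open CommutativeRing R hiding (zero)
  open RingProperties ring
  open SemiringMult semiring using (×-homo-+; ×1-homo-*; ×-homo-1; ×-congˡ) renaming (_×_ to _·_)
  open SemiringSum semiring using (sum-syntax; ∑-distrib-+; *-distribˡ-sum)
  open RawSemiringDefs (Semiring.rawSemiring semiring) using (_^_)
  open NatSolver commutativeSemiring
  open SetoidReasoning setoid

  Seq : Set c
  Seq = ℕ → Carrier

  infix 4 _≐_
  _≐_ : Seq → Seq → Set ℓ
  f ≐ g = ∀ n → f n ≈ g n

  ι : ℕ → Carrier
  ι n = n · 1#

  sign : ℕ → Carrier
  sign n = (- 1#) ^ n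

  x≈z+y⇒x-y≈z : ∀ {x y z} → x ≈ z + y → x - y ≈ z
  x≈z+y⇒x-y≈z {x} {y} {z} eq = trans (+-congʳ eq) (//-rightDividesʳ y z)

  x-[x-y]≈y : ∀ x y → x - (x - y) ≈ y
  x-[x-y]≈y x y = x≈z+y⇒x-y≈z (sym (trans (+-comm y (x - y)) (//-rightDividesˡ y x)))

  ι-* : ∀ m n → ι (m ℕ.* n) ≈ ι m * ι n
  ι-* = ×1-homo-*

  ι-+ : ∀ m n → ι (m ℕ.+ n) ≈ ι m + ι n
  ι-+ = ×-homo-+ 1#

  ι-1 : ι 1 ≈ 1#
  ι-1 = ×-homo-1 1#

  ι-cong : ∀ {m n} → m ≡ n → ι m ≈ ι n
  ι-cong = ×-congˡ

  ·-ι : ∀ n x → n · x ≈ ι n * x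
  ·-ι n x = sym (trans (SemiringMult.×-assoc-* semiring n 1# x) (SemiringMult.×-congʳ semiring n (*-identityˡ x)))

  sign-suc : ∀ n → sign (suc n) ≈ - sign n
  sign-suc n = -1*x≈-x (sign n)

  sign-+ : ∀ m n → sign (m ℕ.+ n) ≈ sign m * sign n
  sign-+ zero    n = sym (*-identityˡ _)
  sign-+ (suc m) n = trans (*-congˡ (sign-+ m n)) (sym (*-assoc _ _ _))

  -1*-1≈1 : - 1# * - 1# ≈ 1#
  -1*-1≈1 = trans (-1*x≈-x (- 1#)) (-‿involutive 1#)

  sign² : ∀ n → sign n * sign n ≈ 1#
  sign² zero    = *-identityˡ 1#
  sign² (suc n) = begin
    (- 1# * sign n) * (- 1# * sign n) ≈⟨ solve 2 (λ x y → (x :* y) :* (x :* y) := (x :* x) :* (y :* y)) refl (- 1#) (sign n) ⟩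
    (- 1# * - 1#) * (sign n * sign n) ≈⟨ *-cong -1*-1≈1 (sign² n) ⟩
    1# * 1#                           ≈⟨ *-identityˡ 1# ⟩
    1#                                ∎

  sign-double : ∀ n → sign (n ℕ.+ n) ≈ 1#
  sign-double n = trans (sign-+ n n) (sign² n)

  -- Finite sums

  Σ< : ℕ → Seq → Carrier
  Σ< n f = ∑[ i < n ] f (toℕ i)

  Σ-cong : ∀ n {f g} → (∀ i → i < n → f i ≈ g i) → Σ< n f ≈ Σ< n g
  Σ-cong zero    f≈g = refl
  Σ-cong (suc n) f≈g = +-cong (f≈g 0 z<s) (Σ-cong n λ i i<n → f≈g (suc i) (s<s i<n))

  Σ-zero : ∀ n {f} → (∀ i → i < n → f i ≈ 0#) → Σ< n f ≈ 0#
  Σ-zero zero    f≈0 = refl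
  Σ-zero (suc n) f≈0 =
    trans (+-cong (f≈0 0 z<s) (Σ-zero n λ i i<n → f≈0 (suc i) (s<s i<n))) (+-identityˡ 0#)

  Σ-last : ∀ n f → Σ< (suc n) f ≈ Σ< n f + f n
  Σ-last zero    f = +-comm _ _
  Σ-last (suc n) f = trans (+-congˡ (Σ-last n (f ∘ suc))) (sym (+-assoc _ _ _))

  Σ-+ : ∀ n f g → Σ< n (λ i → f i + g i) ≈ Σ< n f + Σ< n g
  Σ-+ n f g = ∑-distrib-+ {n} (f ∘ toℕ) (g ∘ toℕ)

  Σ-*ˡ : ∀ n x f → Σ< n (λ i → x * f i) ≈ x * Σ< n f
  Σ-*ˡ n x f = sym (*-distribˡ-sum {n} x (f ∘ toℕ))

  Σ-neg : ∀ n f → Σ< n (λ i → - f i) ≈ - Σ< n f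
  Σ-neg n f = begin
    Σ< n (λ i → - f i)      ≈⟨ Σ-cong n (λ i _ → sym (-1*x≈-x (f i))) ⟩
    Σ< n (λ i → - 1# * f i) ≈⟨ Σ-*ˡ n (- 1#) f ⟩
    - 1# * Σ< n f           ≈⟨ -1*x≈-x _ ⟩
    - Σ< n f                ∎

  Σ-drop : ∀ q n f → (∀ i → i < q → f i ≈ 0#) → Σ< (q ℕ.+ n) f ≈ Σ< n (λ i → f (q ℕ.+ i))
  Σ-drop zero    n f f≈0 = refl
  Σ-drop (suc q) n f f≈0 =
    trans (+-cong (f≈0 0 z<s) (Σ-drop q n (f ∘ suc) λ i i<q → f≈0 (suc i) (s<s i<q))) (+-identityˡ _)

  Σ-truncate : ∀ n k f → (∀ i → n ≤ i → f i ≈ 0#) → Σ< (n ℕ.+ k) f ≈ Σ< n f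
  Σ-truncate zero    k f f≈0 = Σ-zero k (λ i _ → f≈0 i z≤n)
  Σ-truncate (suc n) k f f≈0 = +-congˡ (Σ-truncate n k (f ∘ suc) λ i n≤i → f≈0 (suc i) (s≤s n≤i))

  -- The summand takes both i and n - i as arguments, so that the induction can pass from `h` to
  -- `h ∘ suc` and leave the second index alone.
  Σ-reverse : ∀ n (h : ℕ → ℕ → Carrier) →
    Σ< (suc n) (λ i → h i (n ∸ i)) ≈ Σ< (suc n) (λ i → h (n ∸ i) i)
  Σ-reverse zero    h = refl
  Σ-reverse (suc n) h = begin
    h 0 (suc n) + Σ< (suc n) (λ i → h (suc i) (n ∸ i)) ≈⟨ +-congˡ (Σ-reverse n (h ∘ suc)) ⟩
    h 0 (suc n) + Σ< (suc n) (λ i → h (suc (n ∸ i)) i) ≈⟨ +-comm _ _ ⟩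
    Σ< (suc n) (λ i → h (suc (n ∸ i)) i) + h 0 (suc n)
      ≈⟨ +-cong (Σ-cong (suc n) (λ i i≤n → reflexive (≡.cong (λ j → h j i) (≡.sym (ℕ.+-∸-assoc 1 (ℕ.≤-pred i≤n))))))
                (reflexive (≡.cong (λ j → h j (suc n)) (≡.sym (ℕ.n∸n≡0 n)))) ⟩
    Σ< (suc n) (λ i → h (suc n ∸ i) i) + h (n ∸ n) (suc n) ≈⟨ Σ-last (suc n) (λ i → h (suc n ∸ i) i) ⟨
    Σ< (suc (suc n)) (λ i → h (suc n ∸ i) i) ∎

  -- Iterated differences and the binomial transform

  Δ^ : ℕ → Seq → Seq
  Δ^ zero    f k = f k
  Δ^ (suc m) f k = Δ^ m f k - Δ^ m f (suc k)

  S : Seq → Seq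
  S f n = Δ^ n f 0

  -- Induction on m with n arbitrary. The step is the recursion defining `Δ^` solved for its shifted
  -- term: Δⁿf(m) - Δⁿ⁺¹f(m) = Δⁿf(m+1).
  Δ^-S : ∀ m f n → Δ^ m (S f) n ≈ Δ^ n f m
  Δ^-S zero    f n = refl
  Δ^-S (suc m) f n = trans (+-cong (Δ^-S m f n) (-‿cong (Δ^-S m f (suc n)))) (x-[x-y]≈y _ _)

  S-involutive : ∀ f → S (S f) ≐ f
  S-involutive f n = Δ^-S n f 0

  -- Agreement is asked only up to m + k, the last index that enters, because the equations it is
  -- applied to hold only up to a bound.
  Δ^-cong : ∀ m {f g} k → (∀ i → i ≤ m ℕ.+ k → f i ≈ g i) → Δ^ m f k ≈ Δ^ m g k
  Δ^-cong zero    k f≈g = f≈g k ℕ.≤-refl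
  Δ^-cong (suc m) k f≈g = +-cong
    (Δ^-cong m k λ i i≤ → f≈g i (ℕ.m≤n⇒m≤1+n i≤))
    (-‿cong (Δ^-cong m (suc k) λ i i≤ → f≈g i (≡.subst (i ≤_) (ℕ.+-suc m k) i≤)))

  Δ^-+ : ∀ m f g k → Δ^ m (λ i → f i + g i) k ≈ Δ^ m f k + Δ^ m g k
  Δ^-+ zero    f g k = refl
  Δ^-+ (suc m) f g k = begin
    Δ^ m (λ i → f i + g i) k - Δ^ m (λ i → f i + g i) (suc k)
      ≈⟨ +-cong (Δ^-+ m f g k) (trans (-‿cong (Δ^-+ m f g (suc k))) (sym (-‿+-comm _ _))) ⟩
    (Δ^ m f k + Δ^ m g k) + (- Δ^ m f (suc k) + - Δ^ m g (suc k))
      ≈⟨ solve 4 (λ x y z w → (x :+ y) :+ (z :+ w) := (x :+ z) :+ (y :+ w)) refl _ _ _ _ ⟩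
    Δ^ (suc m) f k + Δ^ (suc m) g k ∎

  Δ^-neg : ∀ m f k → Δ^ m (λ i → - f i) k ≈ - Δ^ m f k
  Δ^-neg zero    f k = refl
  Δ^-neg (suc m) f k = trans (+-cong (Δ^-neg m f k) (-‿cong (Δ^-neg m f (suc k)))) (-‿+-comm _ _)

  Δ^-leading : ∀ m f k → (∀ i → i < m ℕ.+ k → f i ≈ 0#) → Δ^ m f k ≈ sign m * f (m ℕ.+ k)
  Δ^-leading zero    f k f≈0 = sym (*-identityˡ _)
  Δ^-leading (suc m) f k f≈0 = begin
    Δ^ m f k - Δ^ m f (suc k)
      ≈⟨ +-cong (trans (Δ^-leading m f k (λ i i< → f≈0 i (ℕ.m<n⇒m<1+n i<)))
                       (trans (*-congˡ (f≈0 (m ℕ.+ k) ℕ.≤-refl)) (zeroʳ _)))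
                (-‿cong (trans (Δ^-leading m f (suc k) (λ i i< → f≈0 i (≡.subst (i <_) (ℕ.+-suc m k) i<)))
                               (*-congˡ (reflexive (≡.cong f (ℕ.+-suc m k)))))) ⟩
    0# - sign m * f (suc (m ℕ.+ k)) ≈⟨ +-identityˡ _ ⟩
    - (sign m * f (suc (m ℕ.+ k)))  ≈⟨ -‿distribˡ-* _ _ ⟩
    - sign m * f (suc (m ℕ.+ k))    ≈⟨ *-congʳ (sign-suc m) ⟨
    sign (suc m) * f (suc (m ℕ.+ k)) ∎

  Δ^-expand : ∀ m f k → Δ^ m f k ≈ Σ< (suc m) (λ i → sign i * (ι (m C i) * f (k ℕ.+ i)))
  Δ^-expand zero    f k = begin
    f k                          ≈⟨ reflexive (≡.cong f (≡.sym (ℕ.+-identityʳ k))) ⟩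
    f (k ℕ.+ 0)                  ≈⟨ *-identityˡ _ ⟨
    1# * f (k ℕ.+ 0)             ≈⟨ *-congʳ ι-1 ⟨
    ι 1 * f (k ℕ.+ 0)            ≈⟨ *-identityˡ _ ⟨
    1# * (ι 1 * f (k ℕ.+ 0))     ≈⟨ +-identityʳ _ ⟨
    1# * (ι 1 * f (k ℕ.+ 0)) + 0# ∎
  Δ^-expand (suc m) f k = begin
    Δ^ m f k - Δ^ m f (suc k)
      ≈⟨ +-cong (Δ^-expand m f k) (-‿cong (Δ^-expand m f (suc k))) ⟩
    Σ< (suc m) (term m k) - Σ< (suc m) (term m (suc k))
      -- A term with C(m, m+1) = 0 is appended to the first sum. Once its first term is split off,
      -- the two sums have equal length and combine by Pascal's rule.
      ≈⟨ +-congʳ (+-identityʳ _) ⟨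
    (Σ< (suc m) (term m k) + 0#) - Σ< (suc m) (term m (suc k))
      ≈⟨ +-congʳ (+-congˡ (trans (*-congˡ (trans (*-congʳ (ι-cong (k>n⇒nCk≡0 (ℕ.n<1+n m)))) (zeroˡ _))) (zeroʳ _))) ⟨
    (Σ< (suc m) (term m k) + term m k (suc m)) - Σ< (suc m) (term m (suc k))
      ≈⟨ +-cong (Σ-last (suc m) (term m k)) (Σ-neg (suc m) (term m (suc k))) ⟨
    (term m k 0 + Σ< (suc m) (term m k ∘ suc)) + Σ< (suc m) (λ i → - term m (suc k) i)
      ≈⟨ +-assoc _ _ _ ⟩
    term m k 0 + (Σ< (suc m) (term m k ∘ suc) + Σ< (suc m) (λ i → - term m (suc k) i))
      ≈⟨ +-congˡ (Σ-+ (suc m) (term m k ∘ suc) (λ i → - term m (suc k) i)) ⟨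
    term m k 0 + Σ< (suc m) (λ i → term m k (suc i) - term m (suc k) i)
      ≈⟨ +-congˡ (Σ-cong (suc m) (λ i _ → pascal i)) ⟩
    Σ< (suc (suc m)) (term (suc m) k) ∎
    where
    term : ℕ → ℕ → Seq
    term m k i = sign i * (ι (m C i) * f (k ℕ.+ i))

    pascal : ∀ i → term m k (suc i) - term m (suc k) i ≈ term (suc m) k (suc i)
    pascal i = begin
      sign (suc i) * (ι (m C suc i) * f (k ℕ.+ suc i)) - sign i * (ι (m C i) * f (suc k ℕ.+ i))
        ≈⟨ +-congˡ (trans (-‿distribˡ-* _ _) (*-cong (sym (sign-suc i))
             (*-congˡ (reflexive (≡.cong f (≡.sym (ℕ.+-suc k i))))))) ⟩
      sign (suc i) * (ι (m C suc i) * f (k ℕ.+ suc i)) + sign (suc i) * (ι (m C i) * f (k ℕ.+ suc i))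
        ≈⟨ solve 4 (λ s x y z → s :* (x :* z) :+ s :* (y :* z) := s :* ((y :+ x) :* z)) refl _ _ _ _ ⟩
      sign (suc i) * ((ι (m C i) + ι (m C suc i)) * f (k ℕ.+ suc i))
        ≈⟨ *-congˡ (*-congʳ (trans (sym (ι-+ (m C i) (m C suc i))) (ι-cong (nCk+nC[k+1]≡[n+1]C[k+1] m i)))) ⟩
      term (suc m) k (suc i) ∎

  -- Multiplication of power series by u and by 1 - u

  shift : ℕ → Seq → Seq
  shift zero    f n       = f n
  shift (suc i) f zero    = 0#
  shift (suc i) f (suc n) = shift i f n

  ∇ : Seq → Seq
  ∇ f zero    = f zero
  ∇ f (suc n) = f (suc n) - f n

  ∇-cong : ∀ {f g} → f ≐ g → ∇ f ≐ ∇ g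
  ∇-cong f≐g zero    = f≐g zero
  ∇-cong f≐g (suc n) = +-cong (f≐g (suc n)) (-‿cong (f≐g n))

  -- This plays the part of dividing by 1 - u: identities that involve 1/(1 - u) are proved by
  -- applying `∇` to both sides.
  ∇-injective : ∀ {f g} → ∇ f ≐ ∇ g → f ≐ g
  ∇-injective eq zero    = eq zero
  ∇-injective {f} {g} eq (suc n) = begin
    f (suc n)                 ≈⟨ //-rightDividesˡ (f n) _ ⟨
    (f (suc n) - f n) + f n   ≈⟨ +-cong (eq (suc n)) (∇-injective eq n) ⟩
    (g (suc n) - g n) + g n   ≈⟨ //-rightDividesˡ (g n) _ ⟩
    g (suc n)                 ∎

  shift-cong : ∀ i {f g} → f ≐ g → shift i f ≐ shift i g
  shift-cong zero    f≐g n       = f≐g n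
  shift-cong (suc i) f≐g zero    = refl
  shift-cong (suc i) f≐g (suc n) = shift-cong i f≐g n

  ∇-shift : ∀ i f → ∇ (shift i f) ≐ shift i (∇ f)
  ∇-shift zero          f zero          = refl
  ∇-shift zero          f (suc n)       = refl
  ∇-shift (suc i)       f zero          = refl
  ∇-shift (suc zero)    f (suc zero)    = trans (+-congˡ -0#≈0#) (+-identityʳ _)
  ∇-shift (suc (suc i)) f (suc zero)    = trans (+-congˡ -0#≈0#) (+-identityʳ _)
  ∇-shift (suc i)       f (suc (suc n)) = ∇-shift i f (suc n)

  shift-< : ∀ i f n → n < i → shift i f n ≈ 0#
  shift-< (suc i) f zero    _         = refl
  shift-< (suc i) f (suc n) (s≤s n<i) = shift-< i f n n<i

  shift-∸ : ∀ {i n} f → i ≤ n → shift i f n ≡ f (n ∸ i)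
  shift-∸ f z≤n       = ≡.refl
  shift-∸ f (s≤s i≤n) = shift-∸ f i≤n

  shift-shift : ∀ i j f → shift (i ℕ.+ j) f ≐ shift i (shift j f)
  shift-shift zero    j f n       = refl
  shift-shift (suc i) j f zero    = refl
  shift-shift (suc i) j f (suc n) = shift-shift i j f n

  -- P s k is the coefficient of uᵏ in (1 - u)ˢ.
  P : ℤ → Seq
  P (+ s)    k = sign k * ι (s C k)
  P -[1+ s ] k = ι ((s ℕ.+ k) C k)

  P-zero : ∀ s → P s 0 ≈ 1#
  P-zero (+ s)    = trans (*-identityˡ _) ι-1
  P-zero -[1+ s ] = ι-1

  -- Pascal's rule in two guises, for binomials C(s, k) and for multiset coefficients C(s+k, k). It
  -- is the single recursion that treats positive and negative exponents uniformly.
  P-suc : ∀ s → P (ℤ.suc s) ≐ ∇ (P s)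
  P-suc s            zero    = trans (P-zero (ℤ.suc s)) (sym (P-zero s))
  P-suc (+ s)        (suc k) = begin
    sign (suc k) * ι (suc s C suc k)
      ≈⟨ *-congˡ (trans (ι-cong (≡.sym (nCk+nC[k+1]≡[n+1]C[k+1] s k))) (ι-+ (s C k) (s C suc k))) ⟩
    sign (suc k) * (ι (s C k) + ι (s C suc k))
      ≈⟨ solve 3 (λ x y z → x :* (y :+ z) := x :* z :+ x :* y) refl _ _ _ ⟩
    sign (suc k) * ι (s C suc k) + sign (suc k) * ι (s C k)
      ≈⟨ +-congˡ (trans (*-congʳ (sign-suc k)) (sym (-‿distribˡ-* _ _))) ⟩
    sign (suc k) * ι (s C suc k) - sign k * ι (s C k) ∎
  -- The passage from exponent -1 to 0 joins the two formulas: all coefficients of 1/(1 - u) are 1,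
  -- so consecutive ones cancel.
  P-suc -[1+ zero ]  (suc k) = begin
    sign (suc k) * 0#                   ≈⟨ zeroʳ _ ⟩
    0#                                  ≈⟨ x≈y⇒x∙y⁻¹≈ε (ι-cong (≡.trans (nCn≡1 (suc k)) (≡.sym (nCn≡1 k)))) ⟨
    ι (suc k C suc k) - ι (k C k) ∎
  P-suc -[1+ suc s ] (suc k) = sym (x≈z+y⇒x-y≈z (begin
    ι ((suc s ℕ.+ suc k) C suc k)
      ≈⟨ ι-cong (≡.sym (nCk+nC[k+1]≡[n+1]C[k+1] (s ℕ.+ suc k) k)) ⟩
    ι ((s ℕ.+ suc k) C k ℕ.+ (s ℕ.+ suc k) C suc k)
      ≈⟨ ι-+ ((s ℕ.+ suc k) C k) ((s ℕ.+ suc k) C suc k) ⟩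
    ι ((s ℕ.+ suc k) C k) + ι ((s ℕ.+ suc k) C suc k)
      ≈⟨ +-comm _ _ ⟩
    ι ((s ℕ.+ suc k) C suc k) + ι ((s ℕ.+ suc k) C k)
      ≈⟨ +-congˡ (ι-cong (≡.cong (_C k) (ℕ.+-suc s k))) ⟩
    ι ((s ℕ.+ suc k) C suc k) + ι ((suc s ℕ.+ k) C k) ∎))

  -- Σᵢ xᵢ uⁱ (1 - u)^sᵢ
  W : Seq → (ℕ → ℤ) → Seq
  W x s n = Σ< (suc n) (λ i → x i * shift i (P (s i)) n)

  W-suc : ∀ x s → W x (ℤ.suc ∘ s) ≐ ∇ (W x s)
  W-suc x s zero    = +-congʳ (*-congˡ (P-suc (s 0) 0))
  W-suc x s (suc n) = begin
    Σ< (suc (suc n)) (λ i → x i * shift i (P (ℤ.suc (s i))) (suc n))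
      ≈⟨ Σ-cong (suc (suc n)) (λ i _ → term i) ⟩
    Σ< (suc (suc n)) (λ i → x i * shift i (P (s i)) (suc n) - x i * shift i (P (s i)) n)
      ≈⟨ Σ-+ (suc (suc n)) (λ i → x i * shift i (P (s i)) (suc n)) (λ i → - (x i * shift i (P (s i)) n)) ⟩
    W x s (suc n) + Σ< (suc (suc n)) (λ i → - (x i * shift i (P (s i)) n))
      ≈⟨ +-congˡ (Σ-neg (suc (suc n)) (λ i → x i * shift i (P (s i)) n)) ⟩
    W x s (suc n) - Σ< (suc (suc n)) (λ i → x i * shift i (P (s i)) n)
      ≈⟨ +-congˡ (-‿cong (Σ-last (suc n) (λ i → x i * shift i (P (s i)) n))) ⟩
    W x s (suc n) - (W x s n + x (suc n) * shift (suc n) (P (s (suc n))) n)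
      -- The sum for index n + 1 has one term more than `W x s n`; that term carries uⁿ⁺¹ and so has
      -- no coefficient at uⁿ.
      ≈⟨ +-congˡ (-‿cong (trans (+-congˡ (trans (*-congˡ (shift-< (suc n) _ n ℕ.≤-refl)) (zeroʳ _))) (+-identityʳ _))) ⟩
    W x s (suc n) - W x s n ∎
    where
    term : ∀ i → x i * shift i (P (ℤ.suc (s i))) (suc n) ≈
                 x i * shift i (P (s i)) (suc n) - x i * shift i (P (s i)) n
    term i = begin
      x i * shift i (P (ℤ.suc (s i))) (suc n)
        ≈⟨ *-congˡ (trans (shift-cong i (P-suc (s i)) (suc n)) (sym (∇-shift i (P (s i)) (suc n)))) ⟩
      x i * (shift i (P (s i)) (suc n) - shift i (P (s i)) n)
        ≈⟨ x[y-z]≈xy-xz _ _ _ ⟩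
      x i * shift i (P (s i)) (suc n) - x i * shift i (P (s i)) n ∎

  W-cong : ∀ x {s s′} → (∀ i → s i ≡ s′ i) → W x s ≐ W x s′
  W-cong x s≡s′ n = Σ-cong (suc n) (λ i _ → reflexive (≡.cong (λ z → x i * shift i (P z) n) (s≡s′ i)))

  -- Both sides are multiplied by (1 - u)ᵇ, one factor at a time.
  W-translate⁺ : ∀ b x y s s′ → W x s ≐ W y s′ →
    W x (λ i → + b ℤ.+ s i) ≐ W y (λ i → + b ℤ.+ s′ i)
  W-translate⁺ zero x y s s′ eq n = begin
    W x (λ i → + 0 ℤ.+ s i) n  ≈⟨ W-cong x (λ i → ℤ.+-identityˡ (s i)) n ⟩
    W x s n                    ≈⟨ eq n ⟩
    W y s′ n                   ≈⟨ W-cong y (λ i → ℤ.+-identityˡ (s′ i)) n ⟨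
    W y (λ i → + 0 ℤ.+ s′ i) n ∎
  W-translate⁺ (suc b) x y s s′ eq n = begin
    W x (λ i → + suc b ℤ.+ s i) n           ≈⟨ W-cong x (λ i → ℤ.+-assoc (+ 1) (+ b) (s i)) n ⟩
    W x (λ i → ℤ.suc (+ b ℤ.+ s i)) n       ≈⟨ W-suc x (λ i → + b ℤ.+ s i) n ⟩
    ∇ (W x (λ i → + b ℤ.+ s i)) n           ≈⟨ ∇-cong (W-translate⁺ b x y s s′ eq) n ⟩
    ∇ (W y (λ i → + b ℤ.+ s′ i)) n          ≈⟨ W-suc y (λ i → + b ℤ.+ s′ i) n ⟨
    W y (λ i → ℤ.suc (+ b ℤ.+ s′ i)) n      ≈⟨ W-cong y (λ i → ℤ.+-assoc (+ 1) (+ b) (s′ i)) n ⟨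
    W y (λ i → + suc b ℤ.+ s′ i) n          ∎

  -- The factors 1 - u are removed again, one at a time, by injectivity of `∇`.
  W-translate⁻ : ∀ b x y s s′ → W x (λ i → + b ℤ.+ s i) ≐ W y (λ i → + b ℤ.+ s′ i) → W x s ≐ W y s′
  W-translate⁻ zero x y s s′ eq n = begin
    W x s n                    ≈⟨ W-cong x (λ i → ℤ.+-identityˡ (s i)) n ⟨
    W x (λ i → + 0 ℤ.+ s i) n  ≈⟨ eq n ⟩
    W y (λ i → + 0 ℤ.+ s′ i) n ≈⟨ W-cong y (λ i → ℤ.+-identityˡ (s′ i)) n ⟩
    W y s′ n                   ∎
  W-translate⁻ (suc b) x y s s′ eq = W-translate⁻ b x y s s′ (∇-injective (λ n → begin
    ∇ (W x (λ i → + b ℤ.+ s i)) n           ≈⟨ W-suc x (λ i → + b ℤ.+ s i) n ⟨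
    W x (λ i → ℤ.suc (+ b ℤ.+ s i)) n       ≈⟨ W-cong x (λ i → ℤ.+-assoc (+ 1) (+ b) (s i)) n ⟨
    W x (λ i → + suc b ℤ.+ s i) n           ≈⟨ eq n ⟩
    W y (λ i → + suc b ℤ.+ s′ i) n          ≈⟨ W-cong y (λ i → ℤ.+-assoc (+ 1) (+ b) (s′ i)) n ⟩
    W y (λ i → ℤ.suc (+ b ℤ.+ s′ i)) n      ≈⟨ W-suc y (λ i → + b ℤ.+ s′ i) n ⟩
    ∇ (W y (λ i → + b ℤ.+ s′ i)) n          ∎))

-- From the functional equation to the fixed points of T.

module Expansion {c ℓ} (R : CommutativeRing c ℓ) where
  open import Data.Nat.Base using (_<_)
  open CommutativeRing R hiding (zero)
  open RingProperties ring
  open NatSolver commutativeSemiring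
  open SetoidReasoning setoid
  open Sequences R
  open LaurentSeries R
  open Laurent

  conv : Seq → Seq → Seq
  conv f g n = Σ< (suc n) (λ i → f i * g (n ∸ i))

  conv-congˡ : ∀ {f f′} g → f ≐ f′ → conv f g ≐ conv f′ g
  conv-congˡ g f≐f′ n = Σ-cong (suc n) (λ i _ → *-congʳ {g (n ∸ i)} (f≐f′ i))

  conv-congʳ : ∀ f {g g′} → g ≐ g′ → conv f g ≐ conv f g′
  conv-congʳ f g≐g′ n = Σ-cong (suc n) (λ i _ → *-congˡ {f i} (g≐g′ (n ∸ i)))

  conv-neg : ∀ f g → conv (λ i → - f i) g ≐ (λ n → - conv f g n)
  conv-neg f g n = trans (Σ-cong (suc n) (λ i _ → sym (-‿distribˡ-* (f i) (g (n ∸ i)))))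
                         (Σ-neg (suc n) (λ i → f i * g (n ∸ i)))

  prefix : Seq → Seq
  prefix = conv (body t⁻¹)

  -- All coefficients of t⁻¹ are equal, so deleting the first term of the convolution at n + 1
  -- leaves the convolution at n; `prefix` takes partial sums and `∇` undoes it.
  ∇-prefix : ∀ f → ∇ (prefix f) ≐ f
  ∇-prefix f zero    = trans (+-identityʳ _) (*-identityˡ _)
  ∇-prefix f (suc n) = x≈z+y⇒x-y≈z (+-congʳ (*-identityˡ _))

  prefix-* : ∀ x f → prefix (λ i → x * f i) ≐ (λ n → x * prefix f n)
  prefix-* x f n = trans
    (Σ-cong (suc n) (λ i _ → solve 2 (λ a b → con 1 :* (a :* b) := a :* (con 1 :* b)) refl x (f (n ∸ i))))
    (Σ-*ˡ (suc n) x (λ i → 1# * f (n ∸ i)))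

  prefix-shift : ∀ i f → prefix (shift i f) ≐ shift i (prefix f)
  prefix-shift i f = ∇-injective λ n → begin
    ∇ (prefix (shift i f)) n ≈⟨ ∇-prefix (shift i f) n ⟩
    shift i f n              ≈⟨ shift-cong i (∇-prefix f) n ⟨
    shift i (∇ (prefix f)) n ≈⟨ ∇-shift i (prefix f) n ⟨
    ∇ (shift i (prefix f)) n ∎

  conv-one : ∀ f → conv (body one) f ≐ f
  conv-one f n = begin
    1# * f n + Σ< n (λ i → 0# * f (n ∸ suc i)) ≈⟨ +-cong (*-identityˡ _) (Σ-zero n (λ i _ → zeroˡ (f (n ∸ suc i)))) ⟩
    f n + 0#                                   ≈⟨ +-identityʳ _ ⟩
    f n                                        ∎

  conv-t : ∀ f → conv (body t) f ≐ ∇ f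
  conv-t f zero    = trans (+-identityʳ _) (*-identityˡ _)
  conv-t f (suc n) = +-cong (*-identityˡ _) (begin
    - 1# * f n + Σ< n (λ i → 0# * f (n ∸ suc i)) ≈⟨ +-cong (-1*x≈-x _) (Σ-zero n (λ i _ → zeroˡ (f (n ∸ suc i)))) ⟩
    - f n + 0#                                   ≈⟨ +-identityʳ _ ⟩
    - f n                                        ∎)

  body-w-zero : body w 0 ≈ 0#
  body-w-zero = trans (-‿cong (trans (+-identityʳ _) (zeroˡ _))) -0#≈0#

  body-w-suc : ∀ n → body w (suc n) ≈ - 1#
  body-w-suc n = -‿cong (begin
    0# * 1# + (1# * 1# + Σ< n (λ _ → 0# * 1#)) ≈⟨ +-cong (zeroˡ _) (+-cong (*-identityˡ _) (Σ-zero n (λ i _ → zeroˡ _))) ⟩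
    0# + (1# + 0#)                             ≈⟨ +-identityˡ _ ⟩
    1# + 0#                                    ≈⟨ +-identityʳ _ ⟩
    1#                                         ∎)

  conv-w-zero : ∀ f → conv (body w) f 0 ≈ 0#
  conv-w-zero f = trans (+-identityʳ _) (trans (*-congʳ body-w-zero) (zeroˡ _))

  conv-w-suc : ∀ f n → conv (body w) f (suc n) ≈ - prefix f n
  conv-w-suc f n = begin
    body w 0 * f (suc n) + Σ< (suc n) (λ i → body w (suc i) * f (n ∸ i))
      ≈⟨ +-cong (trans (*-congʳ body-w-zero) (zeroˡ _)) (Σ-cong (suc n) (λ i _ → *-congʳ {f (n ∸ i)} (body-w-suc i))) ⟩
    0# + conv (λ _ → - 1#) f n   ≈⟨ +-identityˡ _ ⟩
    conv (λ _ → - 1#) f n        ≈⟨ conv-neg (λ _ → 1#) f n ⟩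
    - prefix f n                 ∎

  conv-w⁻¹ : ∀ f n → conv (body w⁻¹) f n ≈ - ∇ f n
  conv-w⁻¹ f n = begin
    conv (body w⁻¹) f n                 ≈⟨ conv-neg (conv (body one) (body t)) f n ⟩
    - conv (conv (body one) (body t)) f n ≈⟨ -‿cong (conv-congˡ f (conv-one (body t)) n) ⟩
    - conv (body t) f n                 ≈⟨ -‿cong (conv-t f n) ⟩
    - ∇ f n                             ∎

  body-one : body one ≐ P (+ 0)
  body-one zero    = sym (P-zero (+ 0))
  body-one (suc k) = sym (zeroʳ _)

  suc-neg-suc : ∀ n → ℤ.suc (ℤ.- (+ suc n)) ≡ ℤ.- (+ n)
  suc-neg-suc zero    = ≡.refl
  suc-neg-suc (suc n) = ≡.refl

  prefix-P : ∀ n → prefix (P (ℤ.- (+ n))) ≐ P (ℤ.- (+ suc n))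
  prefix-P n = ∇-injective λ k → begin
    ∇ (prefix (P (ℤ.- (+ n)))) k ≈⟨ ∇-prefix _ k ⟩
    P (ℤ.- (+ n)) k              ≡⟨ ≡.cong (λ s → P s k) (suc-neg-suc n) ⟨
    P (ℤ.suc (ℤ.- (+ suc n))) k  ≈⟨ P-suc (ℤ.- (+ suc n)) k ⟩
    ∇ (P (ℤ.- (+ suc n))) k      ∎

  pole-power-t : ∀ n → pole (power t n) ≡ 0
  pole-power-t zero    = ≡.refl
  pole-power-t (suc n) = pole-power-t n

  body-power-t : ∀ n → body (power t n) ≐ P (+ n)
  body-power-t zero    k = body-one k
  body-power-t (suc n) k = begin
    conv (body t) (body (power t n)) k ≈⟨ conv-t _ k ⟩
    ∇ (body (power t n)) k             ≈⟨ ∇-cong (body-power-t n) k ⟩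
    ∇ (P (+ n)) k                      ≈⟨ P-suc (+ n) k ⟨
    P (+ suc n) k                      ∎

  pole-power-t⁻¹ : ∀ n → pole (power t⁻¹ n) ≡ 0
  pole-power-t⁻¹ zero    = ≡.refl
  pole-power-t⁻¹ (suc n) = pole-power-t⁻¹ n

  body-power-t⁻¹ : ∀ n → body (power t⁻¹ n) ≐ P (ℤ.- (+ n))
  body-power-t⁻¹ zero    k = body-one k
  body-power-t⁻¹ (suc n) k = trans (conv-congʳ (body t⁻¹) (body-power-t⁻¹ n) k) (prefix-P n k)

  pole-zpower-t : ∀ s → pole (zpower t t⁻¹ s) ≡ 0
  pole-zpower-t (+ n)    = pole-power-t n
  pole-zpower-t -[1+ n ] = pole-power-t⁻¹ (suc n)

  body-zpower-t : ∀ s → body (zpower t t⁻¹ s) ≐ P s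
  body-zpower-t (+ n)    = body-power-t n
  body-zpower-t -[1+ n ] = body-power-t⁻¹ (suc n)

  pole-power-w : ∀ n → pole (power w n) ≡ 0
  pole-power-w zero    = ≡.refl
  pole-power-w (suc n) = pole-power-w n

  body-power-w : ∀ n → body (power w n) ≐ (λ k → sign n * shift n (P (ℤ.- (+ n))) k)
  body-power-w zero    k       = trans (body-one k) (sym (*-identityˡ _))
  body-power-w (suc n) zero    = trans (conv-w-zero (body (power w n))) (sym (zeroʳ _))
  body-power-w (suc n) (suc k) = begin
    conv (body w) (body (power w n)) (suc k)         ≈⟨ conv-w-suc (body (power w n)) k ⟩
    - prefix (body (power w n)) k                    ≈⟨ -‿cong (conv-congʳ (body t⁻¹) (body-power-w n) k) ⟩
    - prefix (λ k → sign n * shift n (P (ℤ.- (+ n))) k) k ≈⟨ -‿cong (prefix-* (sign n) (shift n (P (ℤ.- (+ n)))) k) ⟩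
    - (sign n * prefix (shift n (P (ℤ.- (+ n)))) k)  ≈⟨ -‿cong (*-congˡ (prefix-shift n (P (ℤ.- (+ n))) k)) ⟩
    - (sign n * shift n (prefix (P (ℤ.- (+ n)))) k)  ≈⟨ -‿cong (*-congˡ (shift-cong n (prefix-P n) k)) ⟩
    - (sign n * shift n (P (ℤ.- (+ suc n))) k)       ≈⟨ -‿distribˡ-* _ _ ⟩
    - sign n * shift n (P (ℤ.- (+ suc n))) k         ≈⟨ *-congʳ (sign-suc n) ⟨
    sign (suc n) * shift n (P (ℤ.- (+ suc n))) k     ∎

  pole-power-w⁻¹ : ∀ n → pole (power w⁻¹ n) ≡ n
  pole-power-w⁻¹ zero    = ≡.refl
  pole-power-w⁻¹ (suc n) = ≡.cong suc (pole-power-w⁻¹ n)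

  body-power-w⁻¹ : ∀ n → body (power w⁻¹ n) ≐ (λ k → sign n * P (+ n) k)
  body-power-w⁻¹ zero    k = trans (body-one k) (sym (*-identityˡ _))
  body-power-w⁻¹ (suc n) k = begin
    conv (body w⁻¹) (body (power w⁻¹ n)) k ≈⟨ conv-w⁻¹ (body (power w⁻¹ n)) k ⟩
    - ∇ (body (power w⁻¹ n)) k             ≈⟨ -‿cong (∇-cong (body-power-w⁻¹ n) k) ⟩
    - ∇ (λ k → sign n * P (+ n) k) k       ≈⟨ -‿cong (∇-* k) ⟩
    - (sign n * ∇ (P (+ n)) k)             ≈⟨ -‿cong (*-congˡ (P-suc (+ n) k)) ⟨
    - (sign n * P (+ suc n) k)             ≈⟨ -‿distribˡ-* _ _ ⟩
    - sign n * P (+ suc n) k               ≈⟨ *-congʳ (sign-suc n) ⟨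
    sign (suc n) * P (+ suc n) k           ∎
    where
    ∇-* : ∇ (λ k → sign n * P (+ n) k) ≐ (λ k → sign n * ∇ (P (+ n)) k)
    ∇-* zero    = refl
    ∇-* (suc k) = sym (x[y-z]≈xy-xz _ _ _)

  extend-cong : ∀ {f g} → f ≐ g → ∀ k → extend f k ≈ extend g k
  extend-cong f≐g (+ n)    = f≐g n
  extend-cong f≐g -[1+ n ] = refl

  extend-* : ∀ x f k → extend (λ n → x * f n) k ≈ x * extend f k
  extend-* x f (+ n)    = refl
  extend-* x f -[1+ n ] = sym (zeroʳ x)

  extend-shift-suc : ∀ i f z → extend (shift (suc i) f) (ℤ.suc z) ≈ extend (shift i f) z
  extend-shift-suc i f (+ n)        = refl
  extend-shift-suc i f -[1+ zero ]  = refl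
  extend-shift-suc i f -[1+ suc n ] = refl

  extend-shift : ∀ i f z → extend (shift i f) (z ℤ.+ + i) ≈ extend f z
  extend-shift zero    f z = reflexive (≡.cong (extend f) (ℤ.+-identityʳ z))
  extend-shift (suc i) f z = begin
    extend (shift (suc i) f) (z ℤ.+ + suc i)
      ≡⟨ ≡.cong (extend (shift (suc i) f)) z+suc ⟩
    extend (shift (suc i) f) (ℤ.suc (z ℤ.+ + i)) ≈⟨ extend-shift-suc i f (z ℤ.+ + i) ⟩
    extend (shift i f) (z ℤ.+ + i)               ≈⟨ extend-shift i f z ⟩
    extend f z                                   ∎
    where
    z+suc : z ℤ.+ + suc i ≡ ℤ.suc (z ℤ.+ + i)
    z+suc = ≡.trans (ℤ.+-comm z (+ suc i)) (≡.trans (ℤ.+-assoc (+ 1) (+ i) z) (≡.cong ℤ.suc (ℤ.+-comm (+ i) z)))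

  [m+n]-m≡n : ∀ m n → + (m ℕ.+ n) ℤ.- + m ≡ + n
  [m+n]-m≡n m n = ≡.trans (ℤ.m-n≡m⊖n (m ℕ.+ n) m)
    (≡.trans (ℤ.⊖-≥ (ℕ.m≤m+n m n)) (≡.cong +_ (ℕ.m+n∸m≡n m n)))

  m-[m+n]≡-n : ∀ m n → + m ℤ.- + (m ℕ.+ n) ≡ ℤ.- (+ n)
  m-[m+n]≡-n m n = ≡.trans (ℤ.m-n≡m⊖n m (m ℕ.+ n))
    (≡.trans (ℤ.⊖-≤ (ℕ.m≤m+n m n)) (≡.cong (λ x → ℤ.- (+ x)) (ℕ.m+n∸m≡n m n)))

  -- From w = -u/(1 - u): the power w^(i-d) is (-1)^(i-d) u^(i-d) (1 - u)^(d-i). Reading the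
  -- coefficient at k + d clears the pole, and writing the sign with i + d, of the same parity as i
  -- - d, keeps its exponent in ℕ. The cases i ≥ d and i ≤ d then share one formula.
  coeff-w : ∀ i d k →
    coeff (zpower w w⁻¹ (+ i ℤ.- + d)) k ≈ sign (i ℕ.+ d) * extend (shift i (P (+ d ℤ.- + i))) (k ℤ.+ + d)
  coeff-w i d k with ℕ.≤-total d i
  ... | inj₁ d≤i with e , ≡.refl ← ℕ.m≤n⇒∃[o]m+o≡n d≤i = begin
    coeff (zpower w w⁻¹ (+ (d ℕ.+ e) ℤ.- + d)) k
      ≡⟨ ≡.cong (λ s → coeff (zpower w w⁻¹ s) k) ([m+n]-m≡n d e) ⟩
    extend (body (power w e)) (k ℤ.+ + pole (power w e))
      ≡⟨ ≡.cong (extend (body (power w e))) (≡.trans (≡.cong (λ p → k ℤ.+ + p) (pole-power-w e)) (ℤ.+-identityʳ k)) ⟩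
    extend (body (power w e)) k
      ≈⟨ extend-cong (body-power-w e) k ⟩
    extend (λ n → sign e * shift e (P (ℤ.- (+ e))) n) k
      ≈⟨ extend-* (sign e) (shift e (P (ℤ.- (+ e)))) k ⟩
    sign e * extend (shift e (P (ℤ.- (+ e)))) k
      ≈⟨ *-cong sign-eq (sym (extend-shift d (shift e (P (ℤ.- (+ e)))) k)) ⟩
    sign (d ℕ.+ e ℕ.+ d) * extend (shift d (shift e (P (ℤ.- (+ e))))) (k ℤ.+ + d)
      ≈⟨ *-congˡ (extend-cong (shift-shift d e (P (ℤ.- (+ e)))) (k ℤ.+ + d)) ⟨
    sign (d ℕ.+ e ℕ.+ d) * extend (shift (d ℕ.+ e) (P (ℤ.- (+ e)))) (k ℤ.+ + d)
      ≡⟨ ≡.cong (λ s → sign (d ℕ.+ e ℕ.+ d) * extend (shift (d ℕ.+ e) (P s)) (k ℤ.+ + d)) (m-[m+n]≡-n d e) ⟨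
    sign (d ℕ.+ e ℕ.+ d) * extend (shift (d ℕ.+ e) (P (+ d ℤ.- + (d ℕ.+ e)))) (k ℤ.+ + d) ∎
    where
    sign-eq : sign e ≈ sign (d ℕ.+ e ℕ.+ d)
    sign-eq = begin
      sign e                     ≈⟨ *-identityˡ _ ⟨
      1# * sign e                ≈⟨ *-congʳ (sign² d) ⟨
      sign d * sign d * sign e   ≈⟨ solve 2 (λ x y → x :* x :* y := x :* y :* x) refl _ _ ⟩
      sign d * sign e * sign d   ≈⟨ *-congʳ (sign-+ d e) ⟨
      sign (d ℕ.+ e) * sign d    ≈⟨ sign-+ (d ℕ.+ e) d ⟨
      sign (d ℕ.+ e ℕ.+ d)       ∎
  ... | inj₂ i≤d with e , ≡.refl ← ℕ.m≤n⇒∃[o]m+o≡n i≤d = begin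
    coeff (zpower w w⁻¹ (+ i ℤ.- + (i ℕ.+ e))) k
      ≡⟨ ≡.cong (λ s → coeff (zpower w w⁻¹ s) k) (m-[m+n]≡-n i e) ⟩
    coeff (zpower w w⁻¹ (ℤ.- (+ e))) k
      ≡⟨ ≡.cong (λ f → coeff f k) (zpower-neg e) ⟩
    extend (body (power w⁻¹ e)) (k ℤ.+ + pole (power w⁻¹ e))
      ≡⟨ ≡.cong (λ p → extend (body (power w⁻¹ e)) (k ℤ.+ + p)) (pole-power-w⁻¹ e) ⟩
    extend (body (power w⁻¹ e)) (k ℤ.+ + e)
      ≈⟨ extend-cong (body-power-w⁻¹ e) (k ℤ.+ + e) ⟩
    extend (λ n → sign e * P (+ e) n) (k ℤ.+ + e)
      ≈⟨ extend-* (sign e) (P (+ e)) (k ℤ.+ + e) ⟩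
    sign e * extend (P (+ e)) (k ℤ.+ + e)
      ≈⟨ *-cong sign-eq (sym (extend-shift i (P (+ e)) (k ℤ.+ + e))) ⟩
    sign (i ℕ.+ (i ℕ.+ e)) * extend (shift i (P (+ e))) (k ℤ.+ + e ℤ.+ + i)
      ≡⟨ ≡.cong₂ (λ s z → sign (i ℕ.+ (i ℕ.+ e)) * extend (shift i (P s)) z) (≡.sym ([m+n]-m≡n i e))
           (≡.trans (ℤ.+-assoc k (+ e) (+ i)) (≡.cong (λ x → k ℤ.+ + x) (ℕ.+-comm e i))) ⟩
    sign (i ℕ.+ (i ℕ.+ e)) * extend (shift i (P (+ (i ℕ.+ e) ℤ.- + i))) (k ℤ.+ + (i ℕ.+ e)) ∎
    where
    zpower-neg : ∀ e → zpower w w⁻¹ (ℤ.- (+ e)) ≡ power w⁻¹ e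
    zpower-neg zero    = ≡.refl
    zpower-neg (suc e) = ≡.refl
    sign-eq : sign e ≈ sign (i ℕ.+ (i ℕ.+ e))
    sign-eq = begin
      sign e                     ≈⟨ *-identityˡ _ ⟨
      1# * sign e                ≈⟨ *-congʳ (sign² i) ⟨
      sign i * sign i * sign e   ≈⟨ *-assoc _ _ _ ⟩
      sign i * (sign i * sign e) ≈⟨ *-congˡ (sign-+ i e) ⟨
      sign i * sign (i ℕ.+ e)    ≈⟨ sign-+ i (i ℕ.+ e) ⟨
      sign (i ℕ.+ (i ℕ.+ e))     ∎

  conv-W : ∀ s γ → conv (P s) γ ≐ W γ (λ _ → s)
  conv-W s γ n = begin
    Σ< (suc n) (λ i → P s i * γ (n ∸ i)) ≈⟨ Σ-reverse n (λ i j → P s i * γ j) ⟩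
    Σ< (suc n) (λ i → P s (n ∸ i) * γ i)
      ≈⟨ Σ-cong (suc n) (λ i i≤n → trans (*-comm _ (γ i)) (*-congˡ (reflexive (≡.sym (shift-∸ (P s) (ℕ.≤-pred i≤n)))))) ⟩
    Σ< (suc n) (λ i → γ i * shift i (P s) n) ∎

  W-zero : ∀ γ → W γ (λ _ → + 0) ≐ γ
  W-zero γ n = begin
    W γ (λ _ → + 0) n                    ≈⟨ conv-W (+ 0) γ n ⟨
    conv (P (+ 0)) γ n                   ≈⟨ conv-congˡ γ body-one n ⟨
    conv (body one) γ n                  ≈⟨ conv-one γ n ⟩
    γ n                                  ∎

  signed : Seq → Seq
  signed γ i = sign i * γ i

  module _ (d : ℕ) (a : ℤ) (γ : Seq) where

    summand : ℤ → Seq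
    summand z i = γ i * (sign (i ℕ.+ d) * extend (shift i (P (+ d ℤ.- + i))) z)

    summand-coeff : ∀ k i → coeff (γ i • zpower w w⁻¹ (+ i ℤ.- + d)) k ≈ summand (k ℤ.+ + d) i
    summand-coeff k i = trans (extend-* (γ i) _ (k ℤ.+ _)) (*-congˡ (coeff-w i d k))

    summand-zero : ∀ n i → n < i → summand (+ n) i ≈ 0#
    summand-zero n i n<i = begin
      γ i * (sign (i ℕ.+ d) * shift i (P (+ d ℤ.- + i)) n) ≈⟨ *-congˡ (*-congˡ (shift-< i _ n n<i)) ⟩
      γ i * (sign (i ℕ.+ d) * 0#)                          ≈⟨ *-congˡ (zeroʳ _) ⟩
      γ i * 0#                                             ≈⟨ zeroʳ _ ⟩
      0#                                                   ∎

    summand-neg : ∀ n i → summand -[1+ n ] i ≈ 0#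
    summand-neg n i = trans (*-congˡ (zeroʳ _)) (zeroʳ _)

    rhs : Seq
    rhs n = sign d * conv (P (ℤ.- a)) γ n

    rhs-coeff : ∀ k → coeff (sign d • (zpower t t⁻¹ (ℤ.- a) *ᴸ (u^- d ∙ γ))) k ≈ extend rhs (k ℤ.+ + d)
    rhs-coeff k = begin
      extend (λ n → sign d * conv (body tˢ) γ n) (k ℤ.+ + (pole tˢ ℕ.+ d))
        ≡⟨ ≡.cong (λ p → extend (λ n → sign d * conv (body tˢ) γ n) (k ℤ.+ + (p ℕ.+ d))) (pole-zpower-t (ℤ.- a)) ⟩
      extend (λ n → sign d * conv (body tˢ) γ n) (k ℤ.+ + d)
        ≈⟨ extend-cong (λ n → *-congˡ (conv-congˡ γ (body-zpower-t (ℤ.- a)) n)) (k ℤ.+ + d) ⟩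
      extend rhs (k ℤ.+ + d) ∎
      where
      tˢ : Laurent
      tˢ = zpower t t⁻¹ (ℤ.- a)

    CoefficientwiseEquation : Set ℓ
    CoefficientwiseEquation = ∀ n → Σ< (suc n) (summand (+ n)) ≈ rhs n

    functional⇒coefficientwise : FunctionalEquation d a γ → CoefficientwiseEquation
    functional⇒coefficientwise fe n = begin
      Σ< (suc n) (summand (+ n))
        -- The number of terms has to exceed n, so that the full coefficient is present, and reach
        -- the bound `N` supplied by the convergence hypothesis; `suc n ℕ.+ N` does both.
        ≈⟨ Σ-truncate (suc n) N (summand (+ n)) (λ i → summand-zero n i) ⟨
      Σ< (suc n ℕ.+ N) (summand (+ n))
        ≡⟨ ≡.cong (λ z → Σ< (suc n ℕ.+ N) (summand z)) k+d ⟨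
      Σ< (suc n ℕ.+ N) (summand (k ℤ.+ + d))
        ≈⟨ Σ-cong (suc n ℕ.+ N) (λ i _ → summand-coeff k i) ⟨
      Σ< (suc n ℕ.+ N) (λ i → coeff (γ i • zpower w w⁻¹ (+ i ℤ.- + d)) k)
        ≈⟨ proj₂ (fe k) (suc n ℕ.+ N) (ℕ.m≤n+m N (suc n)) ⟩
      coeff (sign d • (zpower t t⁻¹ (ℤ.- a) *ᴸ (u^- d ∙ γ))) k
        ≈⟨ rhs-coeff k ⟩
      extend rhs (k ℤ.+ + d)
        ≡⟨ ≡.cong (extend rhs) k+d ⟩
      rhs n ∎
      where
      k : ℤ
      k = + n ℤ.- + d
      N : ℕ
      N = proj₁ (fe k)
      k+d : k ℤ.+ + d ≡ + n
      k+d = ≡.trans (ℤ.+-assoc (+ n) (ℤ.- (+ d)) (+ d))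
              (≡.trans (≡.cong (λ z → + n ℤ.+ z) (ℤ.+-inverseˡ (+ d))) (ℤ.+-identityʳ (+ n)))

    coefficientwise⇒functional : CoefficientwiseEquation → FunctionalEquation d a γ
    coefficientwise⇒functional eq k = bound (k ℤ.+ + d) , λ n n≥ → begin
      Σ< n (λ i → coeff (γ i • zpower w w⁻¹ (+ i ℤ.- + d)) k)
        ≈⟨ Σ-cong n (λ i _ → summand-coeff k i) ⟩
      Σ< n (summand (k ℤ.+ + d))
        ≈⟨ sums (k ℤ.+ + d) n n≥ ⟩
      extend rhs (k ℤ.+ + d)
        ≈⟨ rhs-coeff k ⟨
      coeff (sign d • (zpower t t⁻¹ (ℤ.- a) *ᴸ (u^- d ∙ γ))) k ∎
      where
      bound : ℤ → ℕ
      bound (+ m)    = suc m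
      -- Below the pole order every summand vanishes, so the partial sums are constant from the
      -- start.
      bound -[1+ m ] = 0
      sums : ∀ z n → bound z ≤ n → Σ< n (summand z) ≈ extend rhs z
      sums (+ m) n m<n with k , ≡.refl ← ℕ.m≤n⇒∃[o]m+o≡n m<n =
        trans (Σ-truncate (suc m) k (summand (+ m)) (λ i → summand-zero m i)) (eq m)
      sums -[1+ m ] n _ = Σ-zero n (λ i _ → summand-neg m i)

    coefficientwise-lhs : ∀ n → Σ< (suc n) (summand (+ n)) ≈ sign d * W (signed γ) (λ i → + d ℤ.- + i) n
    coefficientwise-lhs n = begin
      Σ< (suc n) (λ i → γ i * (sign (i ℕ.+ d) * shift i (P (+ d ℤ.- + i)) n))
        ≈⟨ Σ-cong (suc n) (λ i _ → rearrange i (shift i (P (+ d ℤ.- + i)) n)) ⟩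
      Σ< (suc n) (λ i → sign d * (signed γ i * shift i (P (+ d ℤ.- + i)) n))
        ≈⟨ Σ-*ˡ (suc n) (sign d) (λ i → signed γ i * shift i (P (+ d ℤ.- + i)) n) ⟩
      sign d * W (signed γ) (λ i → + d ℤ.- + i) n ∎
      where
      rearrange : ∀ i x → γ i * (sign (i ℕ.+ d) * x) ≈ sign d * (signed γ i * x)
      rearrange i x = begin
        γ i * (sign (i ℕ.+ d) * x)     ≈⟨ *-congˡ (*-congʳ (sign-+ i d)) ⟩
        γ i * ((sign i * sign d) * x)  ≈⟨ solve 4 (λ g s e y → g :* ((s :* e) :* y) := e :* ((s :* g) :* y)) refl _ _ _ _ ⟩
        sign d * ((sign i * γ i) * x)  ∎

  T : ℤ → Seq → Seq
  T r γ = W (signed γ) (λ i → ℤ.- r ℤ.- + i)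

  W-translate : ∀ b x y s s′ → W x s ≐ W y s′ ⇔ W x (λ i → b ℤ.+ s i) ≐ W y (λ i → b ℤ.+ s′ i)
  W-translate (+ b)    x y s s′ = mk⇔ (W-translate⁺ b x y s s′) (W-translate⁻ b x y s s′)
  -- For a negative translation the two directions change places: adding `suc b` to the translated
  -- exponents restores the original ones.
  W-translate -[1+ b ] x y s s′ = mk⇔
    (λ eq → W-translate⁻ (suc b) x y (λ i → -[1+ b ] ℤ.+ s i) (λ i → -[1+ b ] ℤ.+ s′ i) λ n → trans (cancel x s n) (trans (eq n) (sym (cancel y s′ n))))
    (λ eq n → trans (sym (cancel x s n)) (trans (W-translate⁺ (suc b) x y (λ i → -[1+ b ] ℤ.+ s i) (λ i → -[1+ b ] ℤ.+ s′ i) eq n) (cancel y s′ n)))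
    where
    cancel : ∀ x s → W x (λ i → + suc b ℤ.+ (-[1+ b ] ℤ.+ s i)) ≐ W x s
    cancel x s = W-cong x λ i → ≡.trans (≡.sym (ℤ.+-assoc (+ suc b) -[1+ b ] (s i)))
      (≡.trans (≡.cong (ℤ._+ s i) (ℤ.+-inverseʳ (+ suc b))) (ℤ.+-identityˡ (s i)))

  -- After multiplication by uᵈ the equation reads (-1)ᵈ Σᵢ (-1)ⁱ γᵢ uⁱ (1 - u)^(d-i) = (-1)ᵈ (1 -
  -- u)^(-a) Σᵢ γᵢ uⁱ. Cancelling the sign and multiplying by (1 - u)ᵃ clears the right-hand side
  -- and makes the exponents on the left a + d - i = -r - i.
  functional⇔fixed : ∀ d a γ → FunctionalEquation d a γ ⇔ T (ℤ.- (a ℤ.+ + d)) γ ≐ γ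
  functional⇔fixed d a γ = mk⇔
    (λ fe n → begin
      T (ℤ.- (a ℤ.+ + d)) γ n                           ≈⟨ W-cong (signed γ) exponent n ⟨
      W (signed γ) (λ i → a ℤ.+ (+ d ℤ.- + i)) n
        ≈⟨ Equivalence.to translate (λ m → cancel-sign (begin
             sign d * W (signed γ) (λ i → + d ℤ.- + i) m ≈⟨ coefficientwise-lhs d a γ m ⟨
             Σ< (suc m) (summand d a γ (+ m))                ≈⟨ functional⇒coefficientwise d a γ fe m ⟩
             sign d * conv (P (ℤ.- a)) γ m                   ≈⟨ *-congˡ (conv-W (ℤ.- a) γ m) ⟩
             sign d * W γ (λ _ → ℤ.- a) m                    ∎)) n ⟩
      W γ (λ _ → a ℤ.- a) n                             ≈⟨ W-cong γ (λ _ → ℤ.+-inverseʳ a) n ⟩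
      W γ (λ _ → + 0) n                                 ≈⟨ W-zero γ n ⟩
      γ n                                               ∎)
    (λ fixed → coefficientwise⇒functional d a γ (λ m → begin
      Σ< (suc m) (summand d a γ (+ m))                ≈⟨ coefficientwise-lhs d a γ m ⟩
      sign d * W (signed γ) (λ i → + d ℤ.- + i) m
        ≈⟨ *-congˡ (Equivalence.from translate (λ n → begin
             W (signed γ) (λ i → a ℤ.+ (+ d ℤ.- + i)) n ≈⟨ W-cong (signed γ) exponent n ⟩
             T (ℤ.- (a ℤ.+ + d)) γ n                        ≈⟨ fixed n ⟩
             γ n                                            ≈⟨ W-zero γ n ⟨
             W γ (λ _ → + 0) n                              ≈⟨ W-cong γ (λ _ → ℤ.+-inverseʳ a) n ⟨
             W γ (λ _ → a ℤ.- a) n                          ∎) m) ⟩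
      sign d * W γ (λ _ → ℤ.- a) m                    ≈⟨ *-congˡ (conv-W (ℤ.- a) γ m) ⟨
      sign d * conv (P (ℤ.- a)) γ m                   ∎))
    where
    translate = W-translate a (signed γ) γ (λ i → + d ℤ.- + i) (λ _ → ℤ.- a)
    exponent : ∀ i → a ℤ.+ (+ d ℤ.- + i) ≡ ℤ.- (ℤ.- (a ℤ.+ + d)) ℤ.- + i
    exponent i = ≡.trans (≡.sym (ℤ.+-assoc a (+ d) (ℤ.- (+ i)))) (≡.cong (ℤ._- + i) (≡.sym (ℤ.neg-involutive (a ℤ.+ + d))))
    cancel-sign : ∀ {x y} → sign d * x ≈ sign d * y → x ≈ y
    cancel-sign {x} {y} eq = begin
      x                     ≈⟨ *-identityˡ x ⟨
      1# * x                ≈⟨ *-congʳ (sign² d) ⟨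
      sign d * sign d * x   ≈⟨ *-assoc _ _ _ ⟩
      sign d * (sign d * x) ≈⟨ *-congˡ eq ⟩
      sign d * (sign d * y) ≈⟨ *-assoc _ _ _ ⟨
      sign d * sign d * y   ≈⟨ *-congʳ (sign² d) ⟩
      1# * y                ≈⟨ *-identityˡ y ⟩
      y                     ∎

-- Eigenspaces of the binomial transform and the conditions (A) to (D).

module Criteria {c ℓ₁ ℓ₂} (K : HeytingField c ℓ₁ ℓ₂) (char0 : CharacteristicZero K) where
  open import Data.Nat.Base using (_<_)
  open import Data.Nat.Divisibility using (_∣_; divides; _∣?_)
  open HeytingField K using (#⇒invertible)
  open CommutativeRing (scalarRing K) hiding (zero)
  open RingProperties ring
  open SemiringMult semiring using () renaming (_×_ to _·_)
  open Binomials
  open Parity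
  open NatSolver commutativeSemiring
  open SetoidReasoning setoid
  open Sequences (scalarRing K)
  open Expansion (scalarRing K) using (T)
  open LaurentSeries (scalarRing K) using (extend)
  open Conditions K char0 using (recip; ConditionA; ConditionB; ConditionC; ConditionD)

  recip-inverse : ∀ n .{{_ : NonZero n}} → recip n * ι n ≈ 1#
  -- Apartness x # y provides an inverse of x - y; here y is zero, and the subtracted zero has to be
  -- removed.
  recip-inverse (suc n) = trans (*-congˡ (sym (trans (+-congˡ -0#≈0#) (+-identityʳ _))))
                                (proj₁ (proj₂ (#⇒invertible (char0 n))))

  cancelˡ : ∀ {v u x y} → v * u ≈ 1# → u * x ≈ u * y → x ≈ y
  cancelˡ {v} {u} {x} {y} vu≈1 ux≈uy = begin
    x           ≈⟨ *-identityˡ x ⟨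
    1# * x      ≈⟨ *-congʳ vu≈1 ⟨
    v * u * x   ≈⟨ *-assoc v u x ⟩
    v * (u * x) ≈⟨ *-congˡ ux≈uy ⟩
    v * (u * y) ≈⟨ *-assoc v u y ⟨
    v * u * y   ≈⟨ *-congʳ vu≈1 ⟩
    1# * y      ≈⟨ *-identityˡ y ⟩
    y           ∎

  -- The sums in (B), (C) and (D) agree with iterated differences only up to invertible factors,
  -- which may be needed on both sides.
  proportional : ∀ {u u′ v v′ x y} → v * u ≈ 1# → v′ * u′ ≈ 1# → u * x ≈ u′ * y → x ≈ 0# ⇔ y ≈ 0#
  proportional vu≈1 v′u′≈1 eq = mk⇔
    (λ x≈0 → cancelˡ v′u′≈1 (trans (sym eq) (trans (*-congˡ x≈0) (trans (zeroʳ _) (sym (zeroʳ _))))))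
    (λ y≈0 → cancelˡ vu≈1 (trans eq (trans (*-congˡ y≈0) (trans (zeroʳ _) (sym (zeroʳ _))))))

  x≈-x⇒x≈0 : ∀ {x} → x ≈ - x → x ≈ 0#
  x≈-x⇒x≈0 {x} x≈-x = cancelˡ (recip-inverse 2) (begin
    ι 2 * x   ≈⟨ ·-ι 2 x ⟨
    x + (x + 0#) ≈⟨ +-congˡ (+-identityʳ x) ⟩
    x + x     ≈⟨ +-congˡ x≈-x ⟩
    x - x     ≈⟨ -‿inverseʳ x ⟩
    0#        ≈⟨ zeroʳ _ ⟨
    ι 2 * 0#  ∎)

  -- Eigenspaces of the binomial transform

  -- The value Δᵐg(m) involves only the indices m, ..., 2m, which is why the first `N` + 1 equations
  -- correspond exactly to 2m ≤ `N`.
  antifixed⇔differences : ∀ N g →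
    (∀ n → n ≤ N → g n ≈ - S g n) ⇔ (∀ m → m ℕ.+ m ≤ N → Δ^ m g m ≈ 0#)
  antifixed⇔differences N g = mk⇔
    (λ anti m 2m≤N → x≈-x⇒x≈0 (begin
      Δ^ m g m                 ≈⟨ Δ^-cong m m (λ i i≤2m → anti i (ℕ.≤-trans i≤2m 2m≤N)) ⟩
      Δ^ m (λ i → - S g i) m   ≈⟨ Δ^-neg m (S g) m ⟩
      - Δ^ m (S g) m           ≈⟨ -‿cong (Δ^-S m g m) ⟩
      - Δ^ m g m               ∎))
    (λ diff n n≤N → +-inverseˡ-unique _ _ (vanish diff (suc n) n ℕ.≤-refl n≤N))
    where
    δ : Seq
    δ i = g i + S g i

    S-δ : S δ ≐ δ
    S-δ n = begin
      Δ^ n δ 0             ≈⟨ Δ^-+ n g (S g) 0 ⟩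
      S g n + S (S g) n    ≈⟨ +-congˡ (S-involutive g n) ⟩
      S g n + g n          ≈⟨ +-comm _ _ ⟩
      δ n                  ∎

    -- Strong induction on n, with `k` as a strict upper bound that decreases structurally.
    vanish : (∀ m → m ℕ.+ m ≤ N → Δ^ m g m ≈ 0#) → ∀ k n → n < k → n ≤ N → δ n ≈ 0#
    vanish diff (suc k) n n<1+k n≤N with half n
    -- At an even index the leading term of Δʲδ(j) is isolated; this difference is Δʲg(j) counted
    -- twice, by duality, and so is zero.
    ... | inj₁ (j , ≡.refl) = cancelˡ (sign² j) (begin
      sign j * δ (j ℕ.+ j)       ≈⟨ Δ^-leading j δ j lower ⟨
      Δ^ j δ j                   ≈⟨ Δ^-+ j g (S g) j ⟩
      Δ^ j g j + Δ^ j (S g) j    ≈⟨ +-cong (diff j n≤N) (trans (Δ^-S j g j) (diff j n≤N)) ⟩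
      0# + 0#                    ≈⟨ +-identityˡ 0# ⟩
      0#                         ≈⟨ zeroʳ _ ⟨
      sign j * 0#                ∎)
      where
      lower : ∀ i → i < j ℕ.+ j → δ i ≈ 0#
      lower i i<n = vanish diff k i (ℕ.≤-trans i<n (ℕ.≤-pred n<1+k)) (ℕ.≤-trans (ℕ.<⇒≤ i<n) n≤N)
    -- At an odd index no difference condition enters: `δ` is fixed by `S`, and with all lower
    -- entries zero this says δ(n) = -δ(n).
    ... | inj₂ (j , ≡.refl) = x≈-x⇒x≈0 (begin
      δ n                    ≈⟨ S-δ n ⟨
      Δ^ n δ 0               ≈⟨ Δ^-leading n δ 0 lower ⟩
      sign n * δ (n ℕ.+ 0)   ≡⟨ ≡.cong (λ i → sign n * δ i) (ℕ.+-identityʳ n) ⟩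
      sign n * δ n           ≈⟨ *-congʳ (trans (*-congˡ (sign-double j)) (*-identityʳ _)) ⟩
      - 1# * δ n             ≈⟨ -1*x≈-x _ ⟩
      - δ n                  ∎)
      where
      lower : ∀ i → i < n ℕ.+ 0 → δ i ≈ 0#
      lower i i<n+0 = vanish diff k i (ℕ.≤-trans i<n (ℕ.≤-pred n<1+k)) (ℕ.≤-trans (ℕ.<⇒≤ i<n) n≤N)
        where i<n = ≡.subst (i <_) (ℕ.+-identityʳ n) i<n+0

  -- On exponential generating functions this is multiplication by x, while `S` is F(x) ↦ eˣ F(-x).
  -- The two operators therefore anticommute, which is what lets one criterion serve both
  -- eigenvalues.
  weight : Seq → Seq
  weight f zero    = 0#
  weight f (suc n) = ι (suc n) * f n

  -- The absorption identity (n+1) C(n, i) = (i+1) C(n+1, i+1), applied termwise; the minus sign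
  -- comes from the index moving by one.
  S-weight : ∀ f n → S (weight f) (suc n) ≈ - (ι (suc n) * S f n)
  S-weight f n = begin
    S (weight f) (suc n)
      ≈⟨ Δ^-expand (suc n) (weight f) 0 ⟩
    1# * (ι 1 * 0#) + Σ< (suc n) (λ i → sign (suc i) * (ι (suc n C suc i) * (ι (suc i) * f i)))
      ≈⟨ +-cong (trans (*-congˡ (zeroʳ _)) (zeroʳ _)) (Σ-cong (suc n) (λ i _ → term i)) ⟩
    0# + Σ< (suc n) (λ i → - ι (suc n) * (sign i * (ι (n C i) * f i)))
      ≈⟨ +-identityˡ _ ⟩
    Σ< (suc n) (λ i → - ι (suc n) * (sign i * (ι (n C i) * f i)))
      ≈⟨ Σ-*ˡ (suc n) (- ι (suc n)) (λ i → sign i * (ι (n C i) * f i)) ⟩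
    - ι (suc n) * Σ< (suc n) (λ i → sign i * (ι (n C i) * f i))
      ≈⟨ *-congˡ (Δ^-expand n f 0) ⟨
    - ι (suc n) * S f n
      ≈⟨ -‿distribˡ-* _ _ ⟨
    - (ι (suc n) * S f n) ∎
    where
    term : ∀ i → sign (suc i) * (ι (suc n C suc i) * (ι (suc i) * f i)) ≈
                 - ι (suc n) * (sign i * (ι (n C i) * f i))
    term i = begin
      - 1# * sign i * (ι (suc n C suc i) * (ι (suc i) * f i))
        ≈⟨ solve 5 (λ a s b c f → a :* s :* (b :* (c :* f)) := a :* (s :* (b :* c :* f))) refl _ _ _ _ _ ⟩
      - 1# * (sign i * (ι (suc n C suc i) * ι (suc i) * f i))
        ≈⟨ *-congˡ (*-congˡ (*-congʳ (trans (sym (ι-* (suc n C suc i) (suc i)))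
             (trans (ι-cong (≡.sym (absorption n i))) (ι-* (suc n) (n C i)))))) ⟩
      - 1# * (sign i * (ι (suc n) * ι (n C i) * f i))
        ≈⟨ solve 5 (λ a s b c f → a :* (s :* (b :* c :* f)) := a :* b :* (s :* (c :* f))) refl _ _ _ _ _ ⟩
      - 1# * ι (suc n) * (sign i * (ι (n C i) * f i))
        ≈⟨ *-congʳ (-1*x≈-x _) ⟩
      - ι (suc n) * (sign i * (ι (n C i) * f i)) ∎

  -- The criterion for `- S`, applied to `weight f`. Indices move up by one, hence the bound
  -- `suc N`; the condition for exponent 0 is `weight f 0 ≈ 0#`, which holds by definition, so the
  -- list starts at 1 as in (B), (C) and (D).
  fixed⇔differences : ∀ N f → (∀ n → n ≤ N → f n ≈ S f n) ⇔
    (∀ m → suc m ℕ.+ suc m ≤ suc N → Δ^ (suc m) (weight f) (suc m) ≈ 0#)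
  fixed⇔differences N f = mk⇔
    (λ fixed m → Equivalence.to (antifixed⇔differences (suc N) (weight f))
      (λ { zero    _         → sym -0#≈0#
         ; (suc n) (s≤s n≤N) → begin
             ι (suc n) * f n             ≈⟨ *-congˡ (fixed n n≤N) ⟩
             ι (suc n) * S f n           ≈⟨ -‿involutive _ ⟨
             - - (ι (suc n) * S f n)     ≈⟨ -‿cong (S-weight f n) ⟨
             - S (weight f) (suc n)      ∎ })
      (suc m))
    (λ diff n n≤N → cancelˡ (recip-inverse (suc n)) (begin
      ι (suc n) * f n             ≈⟨ Equivalence.from (antifixed⇔differences (suc N) (weight f))
                                       (λ { zero _ → refl ; (suc m) → diff m }) (suc n) (s≤s n≤N) ⟩
      - S (weight f) (suc n)      ≈⟨ -‿cong (S-weight f n) ⟩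
      - - (ι (suc n) * S f n)     ≈⟨ -‿involutive _ ⟩
      ι (suc n) * S f n           ∎))

  -- Conjugation of `S` by a diagonal matrix, stated up to `N` because for r ≤ 0 the diagonal is
  -- invertible only up to -r.
  scaled-fixed : ∀ N (γ τ u v : Seq) → (∀ n → n ≤ N → v n * u n ≈ 1#) →
    (∀ n → n ≤ N → τ n ≈ u n * S (λ i → v i * γ i) n) →
    (∀ n → n ≤ N → τ n ≈ γ n) ⇔ (∀ n → n ≤ N → v n * γ n ≈ S (λ i → v i * γ i) n)
  scaled-fixed N γ τ u v vu≈1 τ≈ = mk⇔
    (λ fixed n n≤N → begin
      v n * γ n             ≈⟨ *-congˡ (fixed n n≤N) ⟨
      v n * τ n             ≈⟨ *-congˡ (τ≈ n n≤N) ⟩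
      v n * (u n * S f n)   ≈⟨ *-assoc _ _ _ ⟨
      v n * u n * S f n     ≈⟨ *-congʳ (vu≈1 n n≤N) ⟩
      1# * S f n            ≈⟨ *-identityˡ _ ⟩
      S f n                 ∎)
    (λ fixed n n≤N → begin
      τ n                   ≈⟨ τ≈ n n≤N ⟩
      u n * S f n           ≈⟨ *-congˡ (fixed n n≤N) ⟨
      u n * (v n * γ n)     ≈⟨ solve 3 (λ x y z → x :* (y :* z) := y :* x :* z) refl _ _ _ ⟩
      v n * u n * γ n       ≈⟨ *-congʳ (vu≈1 n n≤N) ⟩
      1# * γ n              ≈⟨ *-identityˡ _ ⟩
      γ n                   ∎)
    where
    f : Seq
    f i = v i * γ i

  -- Conditions (A) and (D)

  -- For r > 0 this is γ preceded by r - 1 zeros; for r ≤ 0 it is γ without its first 1 - r entries.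
  -- The offset places γ at m - r + i in position (m - 1) + i.
  tail : ℤ → Seq → Seq
  tail r γ k = extend γ (+ suc k ℤ.- r)

  tail-index : ∀ r γ m i → extend γ (+ suc m ℤ.- r ℤ.+ + i) ≈ tail r γ (m ℕ.+ i)
  tail-index r γ m i = reflexive (≡.cong (extend γ) (≡.trans (ℤ.+-assoc (+ suc m) (ℤ.- r) (+ i))
    (≡.trans (≡.cong (λ z → + suc m ℤ.+ z) (ℤ.+-comm (ℤ.- r) (+ i)))
             (≡.sym (ℤ.+-assoc (+ suc m) (+ i) (ℤ.- r))))))

  conditionA⇔ : ∀ r γ m → ConditionA r γ (suc m) ⇔ Δ^ m (tail r γ) m ≈ 0#
  conditionA⇔ r γ m = mk⇔ (trans (sym sum≈)) (trans sum≈)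
    where
    sum≈ : _ ≈ Δ^ m (tail r γ) m
    sum≈ = trans
      (Σ-cong (suc m) (λ i _ → *-congˡ {sign i} (trans (·-ι (m C i) _) (*-congˡ {ι (m C i)} (tail-index r γ m i)))))
      (sym (Δ^-expand m (tail r γ) m))

  -- The factor m + i of (D) is the one that `weight` inserts at index m + i; the denominator m is
  -- independent of i and is cleared.
  conditionD⇔ : ∀ r γ m → ConditionD r γ (suc m) ⇔ Δ^ (suc m) (weight (tail r γ)) (suc m) ≈ 0#
  conditionD⇔ r γ m = proportional (recip-inverse (suc m)) (*-identityˡ 1#) (begin
    ι (suc m) * Σ< (suc (suc m)) termD
      ≈⟨ Σ-*ˡ (suc (suc m)) (ι (suc m)) termD ⟨
    Σ< (suc (suc m)) (λ i → ι (suc m) * termD i)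
      ≈⟨ Σ-cong (suc (suc m)) (λ i _ → term i) ⟩
    Σ< (suc (suc m)) (λ i → sign i * (ι (suc m C i) * (ι (suc (m ℕ.+ i)) * tail r γ (m ℕ.+ i))))
      ≈⟨ Δ^-expand (suc m) (weight (tail r γ)) (suc m) ⟨
    Δ^ (suc m) (weight (tail r γ)) (suc m)
      ≈⟨ *-identityˡ _ ⟨
    1# * Δ^ (suc m) (weight (tail r γ)) (suc m) ∎)
    where
    termD : Seq
    termD i = sign i * (((suc m C i) ℕ.* (suc m ℕ.+ i)) · (recip (suc m) * extend γ (+ suc m ℤ.- r ℤ.+ + i)))
    term : ∀ i → ι (suc m) * termD i ≈ sign i * (ι (suc m C i) * (ι (suc (m ℕ.+ i)) * tail r γ (m ℕ.+ i)))
    term i = begin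
      ι (suc m) * termD i
        ≈⟨ *-congˡ (*-congˡ (trans (·-ι ((suc m C i) ℕ.* (suc m ℕ.+ i)) _)
             (*-cong (ι-* (suc m C i) (suc m ℕ.+ i)) (*-congˡ (tail-index r γ m i))))) ⟩
      ι (suc m) * (sign i * (ι (suc m C i) * ι (suc (m ℕ.+ i)) * (recip (suc m) * tail r γ (m ℕ.+ i))))
        ≈⟨ solve 6 (λ x s a b v y → x :* (s :* (a :* b :* (v :* y))) := (v :* x) :* (s :* (a :* (b :* y)))) refl _ _ _ _ _ _ ⟩
      (recip (suc m) * ι (suc m)) * (sign i * (ι (suc m C i) * (ι (suc (m ℕ.+ i)) * tail r γ (m ℕ.+ i))))
        ≈⟨ trans (*-congʳ (recip-inverse (suc m))) (*-identityˡ _) ⟩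
      sign i * (ι (suc m C i) * (ι (suc (m ℕ.+ i)) * tail r γ (m ℕ.+ i))) ∎

  -- Positive degree r = q + 1.

  module Positive (q : ℕ) (γ : Seq) where

    r : ℤ
    r = + suc q

    exponent : ∀ i → ℤ.- r ℤ.- + i ≡ -[1+ q ℕ.+ i ]
    exponent zero    = ≡.cong -[1+_] (≡.sym (ℕ.+-identityʳ q))
    exponent (suc i) = ≡.cong -[1+_] (≡.sym (ℕ.+-suc q i))

    T-expand : ∀ n → T r γ n ≈ Σ< (suc n) (λ i → sign i * (ι ((q ℕ.+ n) C (n ∸ i)) * γ i))
    T-expand n = Σ-cong (suc n) (λ i i<1+n → term i (ℕ.≤-pred i<1+n))
      where
      term : ∀ i → i ≤ n → sign i * γ i * shift i (P (ℤ.- r ℤ.- + i)) n ≈ sign i * (ι ((q ℕ.+ n) C (n ∸ i)) * γ i)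
      term i i≤n = begin
        sign i * γ i * shift i (P (ℤ.- r ℤ.- + i)) n
          ≡⟨ ≡.cong (sign i * γ i *_) (≡.trans (≡.cong (λ s → shift i (P s) n) (exponent i)) (shift-∸ (P -[1+ q ℕ.+ i ]) i≤n)) ⟩
        sign i * γ i * ι ((q ℕ.+ i ℕ.+ (n ∸ i)) C (n ∸ i))
          ≈⟨ *-congˡ (ι-cong (≡.cong (_C (n ∸ i)) (≡.trans (ℕ.+-assoc q i (n ∸ i)) (≡.cong (q ℕ.+_) (ℕ.m+[n∸m]≡n i≤n))))) ⟩
        sign i * γ i * ι ((q ℕ.+ n) C (n ∸ i))
          ≈⟨ solve 3 (λ s g x → s :* g :* x := s :* (x :* g)) refl _ _ _ ⟩
        sign i * (ι ((q ℕ.+ n) C (n ∸ i)) * γ i) ∎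

    u v : Seq
    u n = ι ((q ℕ.+ n) C n)
    v n = recip ((q ℕ.+ n) C n)

    vu≈1 : ∀ n → v n * u n ≈ 1#
    vu≈1 n = recip-inverse ((q ℕ.+ n) C n) {{C-nonZero (ℕ.m≤n+m n q)}}

    normalised : Seq
    normalised n = v n * γ n

    T-normalised : ∀ n → T r γ n ≈ u n * S normalised n
    T-normalised n = begin
      T r γ n
        ≈⟨ T-expand n ⟩
      Σ< (suc n) (λ i → sign i * (ι ((q ℕ.+ n) C (n ∸ i)) * γ i))
        ≈⟨ Σ-cong (suc n) (λ i i<1+n → term i (ℕ.≤-pred i<1+n)) ⟩
      Σ< (suc n) (λ i → u n * (sign i * (ι (n C i) * normalised i)))
        ≈⟨ Σ-*ˡ (suc n) (u n) (λ i → sign i * (ι (n C i) * normalised i)) ⟩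
      u n * Σ< (suc n) (λ i → sign i * (ι (n C i) * normalised i))
        ≈⟨ *-congˡ (Δ^-expand n normalised 0) ⟨
      u n * S normalised n ∎
      where
      term : ∀ i → i ≤ n → sign i * (ι ((q ℕ.+ n) C (n ∸ i)) * γ i) ≈ u n * (sign i * (ι (n C i) * normalised i))
      term i i≤n = begin
        sign i * (ι ((q ℕ.+ n) C (n ∸ i)) * γ i)
          ≈⟨ *-congˡ (*-congˡ (trans (*-congʳ (vu≈1 i)) (*-identityˡ _))) ⟨
        sign i * (ι ((q ℕ.+ n) C (n ∸ i)) * (v i * u i * γ i))
          ≈⟨ solve 5 (λ s a v u g → s :* (a :* (v :* u :* g)) := s :* (a :* u :* (v :* g))) refl _ _ _ _ _ ⟩
        sign i * (ι ((q ℕ.+ n) C (n ∸ i)) * u i * normalised i)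
          ≈⟨ *-congˡ (*-congʳ (trans (sym (ι-* ((q ℕ.+ n) C (n ∸ i)) ((q ℕ.+ i) C i)))
               (trans (ι-cong (scaling⁺ q i≤n)) (ι-* ((q ℕ.+ n) C n) (n C i))))) ⟩
        sign i * (u n * ι (n C i) * normalised i)
          ≈⟨ solve 4 (λ s u a g → s :* (u :* a :* g) := u :* (s :* (a :* g))) refl _ _ _ _ ⟩
        u n * (sign i * (ι (n C i) * normalised i)) ∎

    -- With γ expressed through `normalised`, each coefficient of (B) is the corresponding
    -- coefficient of the weighted difference times N!/Q. This ratio does not depend on the
    -- summation index, and it is cleared by multiplying with `Q`.
    conditionB⇔ : ∀ m → ConditionB r γ (suc m) ⇔ Δ^ (suc m) (weight normalised) (suc m) ≈ 0#
    conditionB⇔ m = proportional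
      (recip-inverse (q ! ℕ.* (suc m ! ℕ.* suc m !)) {{ℕ.m*n≢0 (q !) (suc m ! ℕ.* suc m !) {{q ℕ.!≢0}} {{suc m ℕ.!* suc m !≢0}}}})
      (recip-inverse (N !) {{N ℕ.!≢0}}) (begin
      ι Q * Σ< (suc (suc m)) (termB ℤ.∣ + (2 ℕ.* suc m) ℤ.+ r ℤ.- + 2 ∣)
        ≡⟨ ≡.cong (λ n → ι Q * Σ< (suc (suc m)) (termB n)) N≡ ⟩
      ι Q * Σ< (suc (suc m)) (termB N)
        ≈⟨ Σ-*ˡ (suc (suc m)) (ι Q) (termB N) ⟨
      Σ< (suc (suc m)) (λ i → ι Q * termB N i)
        ≈⟨ Σ-cong (suc (suc m)) (λ i i<2+m → term i (ℕ.≤-pred i<2+m)) ⟩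
      Σ< (suc (suc m)) (λ i → ι (N !) * (sign i * (ι (suc m C i) * (ι (suc (m ℕ.+ i)) * normalised (m ℕ.+ i)))))
        ≈⟨ Σ-*ˡ (suc (suc m)) (ι (N !)) (λ i → sign i * (ι (suc m C i) * (ι (suc (m ℕ.+ i)) * normalised (m ℕ.+ i)))) ⟩
      ι (N !) * Σ< (suc (suc m)) (λ i → sign i * (ι (suc m C i) * (ι (suc (m ℕ.+ i)) * normalised (m ℕ.+ i))))
        ≈⟨ *-congˡ (Δ^-expand (suc m) (weight normalised) (suc m)) ⟨
      ι (N !) * Δ^ (suc m) (weight normalised) (suc m) ∎)
      where
      N Q : ℕ
      N = suc m ℕ.+ m ℕ.+ q
      Q = q ! ℕ.* (suc m ! ℕ.* suc m !)
      N≡ : ℤ.∣ + (2 ℕ.* suc m) ℤ.+ r ℤ.- + 2 ∣ ≡ N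
      N≡ = ≡.cong (λ x → ℤ.∣ + x ℤ.- + 2 ∣)
        (double+ m q)
      termB : ℕ → Seq
      termB n i = sign i * (((n C (suc m ∸ i)) ℕ.* ((suc m ℕ.+ i) C i)) · γ (m ℕ.+ i))
      term : ∀ i → i ≤ suc m → ι Q * termB N i ≈ ι (N !) * (sign i * (ι (suc m C i) * (ι (suc (m ℕ.+ i)) * normalised (m ℕ.+ i))))
      term i i≤m = begin
        ι Q * termB N i
          ≈⟨ *-congˡ (*-congˡ (·-ι b (γ n))) ⟩
        ι Q * (sign i * (ι b * γ n))
          ≈⟨ *-congˡ (*-congˡ (*-congˡ (trans (*-congʳ (vu≈1 n)) (*-identityˡ _)))) ⟨
        ι Q * (sign i * (ι b * (v n * u n * γ n)))
          ≈⟨ solve 6 (λ q s b v u g → q :* (s :* (b :* (v :* u :* g))) := b :* u :* q :* (s :* (v :* g))) refl _ _ _ _ _ _ ⟩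
        ι b * u n * ι Q * (sign i * normalised n)
          ≈⟨ *-congʳ (trans (*-congʳ (sym (ι-* b ((q ℕ.+ n) C n)))) (sym (ι-* (b ℕ.* ((q ℕ.+ n) C n)) Q))) ⟩
        ι (b ℕ.* ((q ℕ.+ n) C n) ℕ.* Q) * (sign i * normalised n)
          ≈⟨ *-congʳ (trans (ι-cong (coefficientB q m i≤m))
               (trans (ι-* (N !) ((suc m C i) ℕ.* suc n)) (*-congˡ (ι-* (suc m C i) (suc n))))) ⟩
        ι (N !) * (ι (suc m C i) * ι (suc n)) * (sign i * normalised n)
          ≈⟨ solve 5 (λ N a b s g → N :* (a :* b) :* (s :* g) := N :* (s :* (a :* (b :* g)))) refl _ _ _ _ _ ⟩
        ι (N !) * (sign i * (ι (suc m C i) * (ι (suc n) * normalised n))) ∎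
        where
        n b : ℕ
        n = m ℕ.+ i
        b = (N C (suc m ∸ i)) ℕ.* ((suc m ℕ.+ i) C i)

    tail-shift : ∀ n → tail r γ (q ℕ.+ n) ≈ γ n
    tail-shift n = reflexive (≡.cong (extend γ) (≡.trans (ℤ.⊖-≥ (s≤s (ℕ.m≤m+n q n))) (≡.cong +_ (ℕ.m+n∸m≡n q n))))

    tail-zero : ∀ k → k < q → tail r γ k ≈ 0#
    tail-zero k k<q with j , ≡.refl ← ℕ.m≤n⇒∃[o]m+o≡n k<q =
      reflexive (≡.cong (extend γ) (≡.trans (ℤ.⊖-< (s≤s k<q))
        (≡.cong (λ x → ℤ.- (+ x)) (≡.trans (≡.cong (_∸ k) (≡.sym (ℕ.+-suc k j))) (ℕ.m+n∸m≡n k (suc j))))))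

    -- By symmetry C(q+n, n-i) = C(q+n, q+i), so the sum runs over row q + n of the binomial
    -- transform from column q on. The zeros in `tail` fill the earlier columns, and the
    -- displacement costs (-1)^q.
    T-tail : ∀ n → T r γ n ≈ sign q * S (tail r γ) (q ℕ.+ n)
    T-tail n = cancelˡ (sign² q) (begin
      sign q * T r γ n
        ≈⟨ *-congˡ (T-expand n) ⟩
      sign q * Σ< (suc n) (λ i → sign i * (ι ((q ℕ.+ n) C (n ∸ i)) * γ i))
        ≈⟨ Σ-*ˡ (suc n) (sign q) (λ i → sign i * (ι ((q ℕ.+ n) C (n ∸ i)) * γ i)) ⟨
      Σ< (suc n) (λ i → sign q * (sign i * (ι ((q ℕ.+ n) C (n ∸ i)) * γ i)))
        ≈⟨ Σ-cong (suc n) (λ i i<1+n → term i (ℕ.≤-pred i<1+n)) ⟩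
      Σ< (suc n) (λ i → sign (q ℕ.+ i) * (ι ((q ℕ.+ n) C (q ℕ.+ i)) * tail r γ (q ℕ.+ i)))
        ≈⟨ Σ-drop q (suc n) (λ j → sign j * (ι ((q ℕ.+ n) C j) * tail r γ j))
             (λ i i<q → trans (*-congˡ (trans (*-congˡ (tail-zero i i<q)) (zeroʳ _))) (zeroʳ _)) ⟨
      Σ< (q ℕ.+ suc n) (λ j → sign j * (ι ((q ℕ.+ n) C j) * tail r γ j))
        ≡⟨ ≡.cong (λ k → Σ< k (λ j → sign j * (ι ((q ℕ.+ n) C j) * tail r γ j))) (ℕ.+-suc q n) ⟩
      Σ< (suc (q ℕ.+ n)) (λ j → sign j * (ι ((q ℕ.+ n) C j) * tail r γ j))
        ≈⟨ Δ^-expand (q ℕ.+ n) (tail r γ) 0 ⟨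
      S (tail r γ) (q ℕ.+ n)
        ≈⟨ *-identityˡ _ ⟨
      1# * S (tail r γ) (q ℕ.+ n)
        ≈⟨ *-congʳ (sign² q) ⟨
      sign q * sign q * S (tail r γ) (q ℕ.+ n)
        ≈⟨ *-assoc _ _ _ ⟩
      sign q * (sign q * S (tail r γ) (q ℕ.+ n)) ∎)
      where
      term : ∀ i → i ≤ n → sign q * (sign i * (ι ((q ℕ.+ n) C (n ∸ i)) * γ i)) ≈
                           sign (q ℕ.+ i) * (ι ((q ℕ.+ n) C (q ℕ.+ i)) * tail r γ (q ℕ.+ i))
      term i i≤n = trans (sym (*-assoc _ _ _)) (*-cong (sym (sign-+ q i)) (*-cong
        (ι-cong (≡.sym (≡.trans (nCk≡nC[n∸k] (ℕ.+-monoʳ-≤ q i≤n)) (≡.cong ((q ℕ.+ n) C_) (ℕ.[m+n]∸[m+o]≡n∸o q n i)))))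
        (sym (tail-shift i))))

    fixed⇔A : sign q ≈ - 1# → T r γ ≐ γ ⇔ (∀ m → 1 ≤ m → ConditionA r γ m)
    fixed⇔A sign≈-1 = mk⇔
      (λ fixed → λ { (suc m) _ → Equivalence.from (conditionA⇔ r γ m)
        (Equivalence.to (antifixed⇔differences (m ℕ.+ m) (tail r γ)) (λ k _ → antifixed fixed k) m ℕ.≤-refl) })
      (λ condA n → begin
        T r γ n                       ≈⟨ T≈-S n ⟩
        - S (tail r γ) (q ℕ.+ n)      ≈⟨ Equivalence.from (antifixed⇔differences (q ℕ.+ n) (tail r γ))
                                           (λ m _ → Equivalence.to (conditionA⇔ r γ m) (condA (suc m) (s≤s z≤n))) (q ℕ.+ n) ℕ.≤-refl ⟨
        tail r γ (q ℕ.+ n)            ≈⟨ tail-shift n ⟩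
        γ n                           ∎)
      where
      T≈-S : ∀ n → T r γ n ≈ - S (tail r γ) (q ℕ.+ n)
      T≈-S n = trans (T-tail n) (trans (*-congʳ sign≈-1) (-1*x≈-x _))
      antifixed : T r γ ≐ γ → ∀ k → tail r γ k ≈ - S (tail r γ) k
      antifixed fixed k with ℕ.≤-<-connex q k
      ... | inj₁ q≤k with n , ≡.refl ← ℕ.m≤n⇒∃[o]m+o≡n q≤k =
        trans (tail-shift n) (trans (sym (fixed n)) (T≈-S n))
      -- The criterion needs the padding positions as well. There the sequence is zero, and since
      -- `S` is lower triangular its transform is zero too.
      ... | inj₂ k<q = begin
        tail r γ k                          ≈⟨ tail-zero k k<q ⟩
        0#                                  ≈⟨ -0#≈0# ⟨
        - 0#                                ≈⟨ -‿cong (trans (*-congˡ (tail-zero (k ℕ.+ 0) (below ℕ.≤-refl))) (zeroʳ _)) ⟨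
        - (sign k * tail r γ (k ℕ.+ 0))     ≈⟨ -‿cong (Δ^-leading k (tail r γ) 0 (λ i i<k → tail-zero i (below (ℕ.<⇒≤ i<k)))) ⟨
        - S (tail r γ) k                    ∎
        where
        below : ∀ {i} → i ≤ k ℕ.+ 0 → i < q
        below {i} i≤k = ℕ.≤-trans (s≤s (≡.subst (i ≤_) (ℕ.+-identityʳ k) i≤k)) k<q

    fixed⇔B : T r γ ≐ γ ⇔ (∀ m → 1 ≤ m → ConditionB r γ m)
    fixed⇔B = mk⇔
      (λ fixed → λ { (suc m) _ → Equivalence.from (conditionB⇔ m)
        -- The bound is the smallest one that admits the difference of order `suc m`.
        (Equivalence.to (fixed⇔differences (m ℕ.+ suc m) normalised)
          (Equivalence.to (scaled (m ℕ.+ suc m)) (λ n _ → fixed n)) m ℕ.≤-refl) })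
      (λ condB n → Equivalence.from (scaled n)
        (Equivalence.from (fixed⇔differences n normalised)
          (λ m _ → Equivalence.to (conditionB⇔ m) (condB (suc m) (s≤s z≤n)))) n ℕ.≤-refl)
      where
      scaled : ∀ N → (∀ n → n ≤ N → T r γ n ≈ γ n) ⇔ (∀ n → n ≤ N → normalised n ≈ S normalised n)
      scaled N = scaled-fixed N γ (T r γ) u v (λ n _ → vu≈1 n) (λ n _ → T-normalised n)

  -- Degree r = -R ≤ 0: a low block of indices up to R and the tail beyond it.

  module Nonpositive (R : ℕ) (γ : Seq) where

    r : ℤ
    r = ℤ.- (+ R)

    exponent : ∀ i → ℤ.- r ℤ.- + i ≡ R ℤ.⊖ i
    exponent i = ≡.trans (≡.cong (ℤ._- + i) (ℤ.neg-involutive (+ R))) (ℤ.m-n≡m⊖n R i)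

    shift-P : ∀ i n → i ≤ R → i ≤ n → shift i (P (ℤ.- r ℤ.- + i)) n ≈ sign (n ∸ i) * ι ((R ∸ i) C (n ∸ i))
    shift-P i n i≤R i≤n = reflexive (≡.trans
      (≡.cong (λ s → shift i (P s) n) (≡.trans (exponent i) (ℤ.⊖-≥ i≤R)))
      (shift-∸ (P (+ (R ∸ i))) i≤n))

    -- Here (1 - u)^(R-i) has alternating coefficients, which cancel the sign (-1)ⁱ in T. The sign
    -- in the scaling restores the alternation that `S` requires.
    u v : Seq
    u n = sign n * ι (R C n)
    v n = sign n * recip (R C n)

    vu≈1 : ∀ n → n ≤ R → v n * u n ≈ 1#
    vu≈1 n n≤R = begin
      sign n * recip (R C n) * (sign n * ι (R C n))
        ≈⟨ solve 3 (λ s v u → s :* v :* (s :* u) := s :* s :* (v :* u)) refl _ _ _ ⟩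
      sign n * sign n * (recip (R C n) * ι (R C n))
        ≈⟨ *-cong (sign² n) (recip-inverse (R C n) {{C-nonZero n≤R}}) ⟩
      1# * 1#
        ≈⟨ *-identityˡ 1# ⟩
      1# ∎

    normalised : Seq
    normalised n = v n * γ n

    uv*γ≈γ : ∀ n → n ≤ R → u n * normalised n ≈ γ n
    uv*γ≈γ n n≤R = begin
      u n * (v n * γ n)   ≈⟨ solve 3 (λ x y z → x :* (y :* z) := y :* x :* z) refl _ _ _ ⟩
      v n * u n * γ n     ≈⟨ *-congʳ (vu≈1 n n≤R) ⟩
      1# * γ n            ≈⟨ *-identityˡ _ ⟩
      γ n                 ∎

    T-normalised : ∀ n → n ≤ R → T r γ n ≈ u n * S normalised n
    T-normalised n n≤R = begin
      T r γ n
        ≈⟨ Σ-cong (suc n) (λ i i<1+n → term i (ℕ.≤-pred i<1+n)) ⟩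
      Σ< (suc n) (λ i → u n * (sign i * (ι (n C i) * normalised i)))
        ≈⟨ Σ-*ˡ (suc n) (u n) (λ i → sign i * (ι (n C i) * normalised i)) ⟩
      u n * Σ< (suc n) (λ i → sign i * (ι (n C i) * normalised i))
        ≈⟨ *-congˡ (Δ^-expand n normalised 0) ⟨
      u n * S normalised n ∎
      where
      term : ∀ i → i ≤ n → sign i * γ i * shift i (P (ℤ.- r ℤ.- + i)) n ≈ u n * (sign i * (ι (n C i) * normalised i))
      term i i≤n = begin
        sign i * γ i * shift i (P (ℤ.- r ℤ.- + i)) n
          ≈⟨ *-cong (*-congˡ (sym (uv*γ≈γ i i≤R))) (shift-P i n i≤R i≤n) ⟩
        sign i * (sign i * ι (R C i) * normalised i) * (sign (n ∸ i) * ι ((R ∸ i) C (n ∸ i)))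
          ≈⟨ solve 5 (λ s x g t y → s :* (s :* x :* g) :* (t :* y) := s :* t :* (y :* x) :* (s :* g)) refl _ _ _ _ _ ⟩
        sign i * sign (n ∸ i) * (ι ((R ∸ i) C (n ∸ i)) * ι (R C i)) * (sign i * normalised i)
          ≈⟨ *-congʳ (*-cong
               (trans (sym (sign-+ i (n ∸ i))) (reflexive (≡.cong sign (ℕ.m+[n∸m]≡n i≤n))))
               (trans (sym (ι-* ((R ∸ i) C (n ∸ i)) (R C i)))
                 (trans (ι-cong (scaling⁻ i≤n n≤R)) (ι-* (R C n) (n C i))))) ⟩
        sign n * (ι (R C n) * ι (n C i)) * (sign i * normalised i)
          ≈⟨ solve 5 (λ s x y t g → s :* (x :* y) :* (t :* g) := s :* x :* (t :* (y :* g))) refl _ _ _ _ _ ⟩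
        u n * (sign i * (ι (n C i) * normalised i)) ∎
        where
        i≤R : i ≤ R
        i≤R = ℕ.≤-trans i≤n n≤R

    ∣1-r∣≡1+R : ℤ.∣ + 1 ℤ.- r ∣ ≡ suc R
    ∣1-r∣≡1+R = ≡.cong (λ z → ℤ.∣ + 1 ℤ.+ z ∣) (ℤ.neg-involutive (+ R))

    -- With n = m + i, absorption gives (R+1) / C(R+1, n+1) = (n+1) / C(R, n), which is the weight
    -- times the rescaling. The sign (-1)ⁿ in the rescaling accounts for (C) having no alternating
    -- sign. The hypothesis keeps n at most R throughout.
    conditionC⇔ : ∀ m → suc m ℕ.+ suc m ≤ suc R →
      ConditionC r γ (suc m) ⇔ Δ^ (suc m) (weight normalised) (suc m) ≈ 0#
    conditionC⇔ m 2m≤1+R = proportional (recip-inverse (suc R)) (sign² m) (begin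
      ι (suc R) * Σ< (suc (suc m)) (termC ℤ.∣ + 1 ℤ.- r ∣)
        ≡⟨ ≡.cong (λ n → ι (suc R) * Σ< (suc (suc m)) (termC n)) ∣1-r∣≡1+R ⟩
      ι (suc R) * Σ< (suc (suc m)) (termC (suc R))
        ≈⟨ Σ-*ˡ (suc (suc m)) (ι (suc R)) (termC (suc R)) ⟨
      Σ< (suc (suc m)) (λ i → ι (suc R) * termC (suc R) i)
        ≈⟨ Σ-cong (suc (suc m)) (λ i i<2+m → term i (ℕ.≤-pred i<2+m)) ⟩
      Σ< (suc (suc m)) (λ i → sign m * (sign i * (ι (suc m C i) * (ι (suc (m ℕ.+ i)) * normalised (m ℕ.+ i)))))
        ≈⟨ Σ-*ˡ (suc (suc m)) (sign m) (λ i → sign i * (ι (suc m C i) * (ι (suc (m ℕ.+ i)) * normalised (m ℕ.+ i)))) ⟩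
      sign m * Σ< (suc (suc m)) (λ i → sign i * (ι (suc m C i) * (ι (suc (m ℕ.+ i)) * normalised (m ℕ.+ i))))
        ≈⟨ *-congˡ (Δ^-expand (suc m) (weight normalised) (suc m)) ⟨
      sign m * Δ^ (suc m) (weight normalised) (suc m) ∎)
      where
      termC : ℕ → Seq
      termC N i = (suc m C i) · (recip (N C (suc m ℕ.+ i)) * γ (m ℕ.+ i))
      term : ∀ i → i ≤ suc m → ι (suc R) * termC (suc R) i ≈
             sign m * (sign i * (ι (suc m C i) * (ι (suc (m ℕ.+ i)) * normalised (m ℕ.+ i))))
      term i i≤m = begin
        ι (suc R) * termC (suc R) i
          ≈⟨ *-congˡ (trans (·-ι (suc m C i) _) (*-congˡ (*-congˡ (sym (uv*γ≈γ n n≤R))))) ⟩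
        ι (suc R) * (ι (suc m C i) * (recip (suc R C suc n) * (sign n * ι (R C n) * normalised n)))
          ≈⟨ solve 6 (λ x a v s y g → x :* (a :* (v :* (s :* y :* g))) := v :* (x :* y) :* (s :* (a :* g))) refl _ _ _ _ _ _ ⟩
        recip (suc R C suc n) * (ι (suc R) * ι (R C n)) * (sign n * (ι (suc m C i) * normalised n))
          ≈⟨ *-congʳ (*-congˡ (trans (sym (ι-* (suc R) (R C n))) (trans (ι-cong (absorption R n)) (ι-* (suc R C suc n) (suc n))))) ⟩
        recip (suc R C suc n) * (ι (suc R C suc n) * ι (suc n)) * (sign n * (ι (suc m C i) * normalised n))
          ≈⟨ *-congʳ (trans (sym (*-assoc _ _ _)) (trans (*-congʳ (recip-inverse (suc R C suc n) {{C-nonZero (s≤s n≤R)}})) (*-identityˡ _))) ⟩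
        ι (suc n) * (sign n * (ι (suc m C i) * normalised n))
          ≈⟨ *-congˡ (*-congʳ (sign-+ m i)) ⟩
        ι (suc n) * (sign m * sign i * (ι (suc m C i) * normalised n))
          ≈⟨ solve 5 (λ b s t a g → b :* (s :* t :* (a :* g)) := s :* (t :* (a :* (b :* g)))) refl _ _ _ _ _ ⟩
        sign m * (sign i * (ι (suc m C i) * (ι (suc n) * normalised n))) ∎
        where
        n : ℕ
        n = m ℕ.+ i
        n≤R : n ≤ R
        n≤R = ℕ.≤-trans (ℕ.+-monoʳ-≤ m i≤m) (ℕ.≤-pred 2m≤1+R)

    fixed⇔C : (∀ n → n ≤ R → T r γ n ≈ γ n) ⇔ (∀ m → 1 ≤ m → m ℕ.+ m ≤ suc R → ConditionC r γ m)
    fixed⇔C = mk⇔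
      (λ fixed → λ { (suc m) _ 2m≤ → Equivalence.from (conditionC⇔ m 2m≤)
        (Equivalence.to (fixed⇔differences R normalised) (Equivalence.to scaled fixed) m 2m≤) })
      (λ condC → Equivalence.from scaled (Equivalence.from (fixed⇔differences R normalised)
        (λ m 2m≤ → Equivalence.to (conditionC⇔ m 2m≤) (condC (suc m) (s≤s z≤n) 2m≤))))
      where
      scaled : (∀ n → n ≤ R → T r γ n ≈ γ n) ⇔ (∀ n → n ≤ R → normalised n ≈ S normalised n)
      scaled = scaled-fixed R γ (T r γ) u v vu≈1 T-normalised

    tail≈ : ∀ k → tail r γ k ≈ γ (suc R ℕ.+ k)
    tail≈ k = reflexive (≡.trans (≡.cong (λ z → extend γ (+ suc k ℤ.+ z)) (ℤ.neg-involutive (+ R)))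
                                 (≡.cong (γ ∘ suc) (ℕ.+-comm k R)))

    -- For i ≤ R the polynomial uⁱ(1 - u)^(R-i) has degree R and contributes nothing beyond R. For i
    -- = R + 1 + j the exponent is -(1 + j), whatever R is, and the coefficient is C(k, j).
    T-tail : ∀ k → T r γ (suc R ℕ.+ k) ≈ sign (suc R) * S (tail r γ) k
    T-tail k = begin
      Σ< (suc (suc R ℕ.+ k)) summand
        ≡⟨ ≡.cong (λ n → Σ< n summand) (≡.sym (ℕ.+-suc (suc R) k)) ⟩
      Σ< (suc R ℕ.+ suc k) summand
        ≈⟨ Σ-drop (suc R) (suc k) summand (λ i i<1+R → low i (ℕ.≤-pred i<1+R)) ⟩
      Σ< (suc k) (λ j → summand (suc R ℕ.+ j))
        ≈⟨ Σ-cong (suc k) (λ j j<1+k → high j (ℕ.≤-pred j<1+k)) ⟩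
      Σ< (suc k) (λ j → sign (suc R) * (sign j * (ι (k C j) * tail r γ j)))
        ≈⟨ Σ-*ˡ (suc k) (sign (suc R)) (λ j → sign j * (ι (k C j) * tail r γ j)) ⟩
      sign (suc R) * Σ< (suc k) (λ j → sign j * (ι (k C j) * tail r γ j))
        ≈⟨ *-congˡ (Δ^-expand k (tail r γ) 0) ⟨
      sign (suc R) * S (tail r γ) k ∎
      where
      summand : Seq
      summand i = sign i * γ i * shift i (P (ℤ.- r ℤ.- + i)) (suc R ℕ.+ k)

      low : ∀ i → i ≤ R → summand i ≈ 0#
      low i i≤R = begin
        summand i
          ≈⟨ *-congˡ (shift-P i (suc R ℕ.+ k) i≤R (ℕ.≤-trans i≤R R≤)) ⟩
        sign i * γ i * (sign (suc R ℕ.+ k ∸ i) * ι ((R ∸ i) C (suc R ℕ.+ k ∸ i)))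
          ≈⟨ *-congˡ (*-congˡ (ι-cong (k>n⇒nCk≡0 (ℕ.∸-monoˡ-< (s≤s (ℕ.m≤m+n R k)) i≤R)))) ⟩
        sign i * γ i * (sign (suc R ℕ.+ k ∸ i) * 0#)
          ≈⟨ trans (*-congˡ (zeroʳ _)) (zeroʳ _) ⟩
        0# ∎
        where
        R≤ : R ≤ suc R ℕ.+ k
        R≤ = ℕ.m≤n⇒m≤1+n (ℕ.m≤m+n R k)

      exponent-high : ∀ j → ℤ.- r ℤ.- + (suc R ℕ.+ j) ≡ -[1+ j ]
      exponent-high j = ≡.trans (exponent (suc R ℕ.+ j)) (≡.trans (ℤ.⊖-< (s≤s (ℕ.m≤m+n R j)))
        (≡.cong (λ x → ℤ.- (+ x)) (≡.trans (≡.cong (_∸ R) (≡.sym (ℕ.+-suc R j))) (ℕ.m+n∸m≡n R (suc j)))))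

      high : ∀ j → j ≤ k → summand (suc R ℕ.+ j) ≈ sign (suc R) * (sign j * (ι (k C j) * tail r γ j))
      high j j≤k = begin
        summand (suc R ℕ.+ j)
          ≈⟨ *-cong (*-cong (sign-+ (suc R) j) (sym (tail≈ j))) (reflexive (≡.trans
               (≡.cong (λ s → shift (suc R ℕ.+ j) (P s) (suc R ℕ.+ k)) (exponent-high j))
               (≡.trans (shift-∸ (P -[1+ j ]) (ℕ.+-monoʳ-≤ (suc R) j≤k))
                        (≡.cong (P -[1+ j ]) (ℕ.[m+n]∸[m+o]≡n∸o (suc R) k j))))) ⟩
        sign (suc R) * sign j * tail r γ j * ι ((j ℕ.+ (k ∸ j)) C (k ∸ j))
          ≈⟨ *-congˡ (ι-cong (≡.trans (≡.cong (_C (k ∸ j)) (ℕ.m+[n∸m]≡n j≤k)) (≡.sym (nCk≡nC[n∸k] j≤k)))) ⟩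
        sign (suc R) * sign j * tail r γ j * ι (k C j)
          ≈⟨ solve 4 (λ s t g x → s :* t :* g :* x := s :* (t :* (x :* g))) refl _ _ _ _ ⟩
        sign (suc R) * (sign j * (ι (k C j) * tail r γ j)) ∎

    FixedTail : Set ℓ₁
    FixedTail = ∀ k → T r γ (suc R ℕ.+ k) ≈ γ (suc R ℕ.+ k)

    fixed⇔A : sign R ≈ 1# → FixedTail ⇔ (∀ m → 1 ≤ m → ConditionA r γ m)
    fixed⇔A sign≈1 = mk⇔
      (λ fixed → λ { (suc m) _ → Equivalence.from (conditionA⇔ r γ m)
        (Equivalence.to (antifixed⇔differences (m ℕ.+ m) (tail r γ))
          (λ k _ → trans (tail≈ k) (trans (sym (fixed k)) (T≈-S k))) m ℕ.≤-refl) })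
      (λ condA k → trans (T≈-S k) (trans (sym (Equivalence.from (antifixed⇔differences k (tail r γ))
        (λ m _ → Equivalence.to (conditionA⇔ r γ m) (condA (suc m) (s≤s z≤n))) k ℕ.≤-refl)) (tail≈ k)))
      where
      T≈-S : ∀ k → T r γ (suc R ℕ.+ k) ≈ - S (tail r γ) k
      T≈-S k = trans (T-tail k) (trans (*-congʳ (trans (*-congˡ sign≈1) (*-identityʳ _))) (-1*x≈-x _))

    fixed⇔D : sign R ≈ - 1# → FixedTail ⇔ (∀ m → 1 ≤ m → ConditionD r γ m)
    fixed⇔D sign≈-1 = mk⇔
      (λ fixed → λ { (suc m) _ → Equivalence.from (conditionD⇔ r γ m)
        (Equivalence.to (fixed⇔differences (m ℕ.+ suc m) (tail r γ))
          (λ k _ → trans (tail≈ k) (trans (sym (fixed k)) (T≈S k))) m ℕ.≤-refl) })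
      (λ condD k → trans (T≈S k) (trans (sym (Equivalence.from (fixed⇔differences k (tail r γ))
        (λ m _ → Equivalence.to (conditionD⇔ r γ m) (condD (suc m) (s≤s z≤n))) k ℕ.≤-refl)) (tail≈ k)))
      where
      T≈S : ∀ k → T r γ (suc R ℕ.+ k) ≈ S (tail r γ) k
      T≈S k = trans (T-tail k) (trans (*-congʳ (trans (*-congˡ sign≈-1) -1*-1≈1)) (*-identityˡ _))

    fixed-split : T r γ ≐ γ ⇔ ((∀ n → n ≤ R → T r γ n ≈ γ n) × FixedTail)
    fixed-split = mk⇔ (λ fixed → (λ n _ → fixed n) , (λ k → fixed (suc R ℕ.+ k))) from
      where
      from : (∀ n → n ≤ R → T r γ n ≈ γ n) × FixedTail → T r γ ≐ γ
      from (low , high) n with ℕ.≤-<-connex n R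
      ... | inj₁ n≤R = low n n≤R
      ... | inj₂ R<n with k , ≡.refl ← ℕ.m≤n⇒∃[o]m+o≡n R<n = high k

  sign-even : ∀ {n} → 2 ∣ n → sign n ≈ 1#
  sign-even (divides j ≡.refl) = trans (reflexive (≡.cong sign (*2≡+ j))) (sign-double j)

  sign-odd : ∀ {n} → ¬ 2 ∣ n → sign n ≈ - 1#
  sign-odd {n} ¬2∣n with half n
  ... | inj₁ (j , n≡j+j) = contradiction (divides j (≡.trans n≡j+j (≡.sym (*2≡+ j)))) ¬2∣n
  ... | inj₂ (j , ≡.refl) = trans (*-congˡ (sign-double j)) (*-identityʳ _)

  -- Assembly by the sign and the parity of the degree.

  DegreeConditions : ℤ → Seq → Set ℓ₁
  DegreeConditions r γ =
      (2 ∣ ℤ.∣ r ∣ → ∀ m → 1 ≤ m → ConditionA r γ m)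
    × (+ 0 ℤ.< r → ¬ (2 ∣ ℤ.∣ r ∣) → ∀ m → 1 ≤ m → ConditionB r γ m)
    × (r ℤ.< + 0 → ∀ m → 1 ≤ m → m ≤ ⌈ ℤ.∣ r ∣ /2⌉ → ConditionC r γ m)
    × (r ℤ.< + 0 → ¬ (2 ∣ ℤ.∣ r ∣) → ∀ m → 1 ≤ m → ConditionD r γ m)

  fixed⇔conditions-positive : ∀ q γ → T (+ suc q) γ ≐ γ ⇔ DegreeConditions (+ suc q) γ
  fixed⇔conditions-positive q γ = mk⇔
    (λ fixed → (λ even → Equivalence.to (fixed⇔A (sign-q even)) fixed)
             , (λ _ _ → Equivalence.to fixed⇔B fixed)
             , (λ { (ℤ.+<+ ()) })
             , (λ { (ℤ.+<+ ()) }))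
    from
    where
    open Positive q γ
    sign-q : 2 ∣ suc q → sign q ≈ - 1#
    sign-q even = begin
      sign q        ≈⟨ -‿involutive _ ⟨
      - - sign q    ≈⟨ -‿cong (sign-suc q) ⟨
      - sign (suc q) ≈⟨ -‿cong (sign-even even) ⟩
      - 1#          ∎
    from : DegreeConditions r γ → T r γ ≐ γ
    from (condA , condB , _) with 2 ∣? suc q
    ... | yes even = Equivalence.from (fixed⇔A (sign-q even)) (condA even)
    ... | no  odd  = Equivalence.from fixed⇔B (condB (ℤ.+<+ z<s) odd)

  fixed⇔conditions-nonpositive : ∀ R γ → T (ℤ.- (+ R)) γ ≐ γ ⇔ DegreeConditions (ℤ.- (+ R)) γ
  fixed⇔conditions-nonpositive R γ = mk⇔ to from
    where
    open Nonpositive R γ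
    ∣r∣≡R : ℤ.∣ r ∣ ≡ R
    ∣r∣≡R = ℤ.∣-i∣≡∣i∣ (+ R)
    ¬r>0 : ¬ (+ 0 ℤ.< r)
    ¬r>0 0<r = ℤ.<⇒≱ 0<r (ℤ.neg-mono-≤ (ℤ.+≤+ (z≤n {R})))
    r<0 : 1 ≤ R → r ℤ.< + 0
    r<0 1≤R = ℤ.neg-mono-< (ℤ.+<+ 1≤R)
    even⇒sign : 2 ∣ ℤ.∣ r ∣ → sign R ≈ 1#
    even⇒sign even = sign-even (≡.subst (2 ∣_) ∣r∣≡R even)
    odd⇒sign : ¬ 2 ∣ ℤ.∣ r ∣ → sign R ≈ - 1#
    odd⇒sign odd = sign-odd (odd ∘ ≡.subst (2 ∣_) (≡.sym ∣r∣≡R))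
    to : T r γ ≐ γ → DegreeConditions r γ
    to fixed with low , high ← Equivalence.to fixed-split fixed =
        (λ even → Equivalence.to (fixed⇔A (even⇒sign even)) high)
      , (λ 0<r → contradiction 0<r ¬r>0)
      , (λ _ m 1≤m m≤ → Equivalence.to fixed⇔C low m 1≤m
           (≡.subst (λ n → m ℕ.+ m ≤ suc n) ∣r∣≡R (≤⌈/2⌉⇒double≤ m ℤ.∣ r ∣ m≤)))
      , (λ _ odd → Equivalence.to (fixed⇔D (odd⇒sign odd)) high)
    -- Condition (C) is available only for r < 0. At r = 0 no m ≥ 1 satisfies 2m ≤ 1, so any m in
    -- the required range already forces R ≥ 1.
    1≤R-of-double : ∀ m → 1 ≤ m → m ℕ.+ m ≤ suc R → 1 ≤ R
    1≤R-of-double (suc m) _ 2m≤ = ℕ.≤-trans (≡.subst (1 ≤_) (≡.sym (ℕ.+-suc m m)) (s≤s z≤n)) (ℕ.≤-pred 2m≤)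
    1≤R-of-odd : ¬ 2 ∣ ℤ.∣ r ∣ → 1 ≤ R
    1≤R-of-odd odd = ℕ.n≢0⇒n>0 λ { ≡.refl → odd (divides 0 ≡.refl) }
    from : DegreeConditions r γ → T r γ ≐ γ
    from (condA , _ , condC , condD) = Equivalence.from fixed-split (low , high)
      where
      low : ∀ n → n ≤ R → T r γ n ≈ γ n
      low = Equivalence.from fixed⇔C λ m 1≤m 2m≤ → condC (r<0 (1≤R-of-double m 1≤m 2m≤)) m 1≤m
        (double≤⇒≤⌈/2⌉ m ℤ.∣ r ∣ (≡.subst (λ n → m ℕ.+ m ≤ suc n) (≡.sym ∣r∣≡R) 2m≤))
      high : FixedTail
      high with 2 ∣? ℤ.∣ r ∣
      ... | yes even = Equivalence.from (fixed⇔A (even⇒sign even)) (condA even)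
      ... | no  odd  = Equivalence.from (fixed⇔D (odd⇒sign odd)) (condD (r<0 (1≤R-of-odd odd)) odd)

  fixed⇔conditions : ∀ r γ → T r γ ≐ γ ⇔ DegreeConditions r γ
  fixed⇔conditions (+ zero)  = fixed⇔conditions-nonpositive 0
  fixed⇔conditions (+ suc q) = fixed⇔conditions-positive q
  fixed⇔conditions -[1+ n ]  = fixed⇔conditions-nonpositive (suc n)

open import Data.Integer.Base using (_+_; -_; _<_; ∣_∣)
open import Data.Integer.Divisibility using (_∣_)
open import Level using (Level)

theorem1p1 : {c ℓ₁ ℓ₂ : Level} (K : HeytingField c ℓ₁ ℓ₂) (char0 : CharacteristicZero K)
  (d : ℕ) (a : ℤ) (γ : ℕ → HeytingField.Carrier K) →
  let open LaurentSeries (scalarRing K)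
      open Conditions K char0
      r = - (a + + d)
  in
  FunctionalEquation d a γ ⇔
    ( (+ 2 ∣ r → ∀ m → 1 ≤ m → ConditionA r γ m)
    × (+ 0 < r → ¬ (+ 2 ∣ r) → ∀ m → 1 ≤ m → ConditionB r γ m)
    × (r < + 0 → ∀ m → 1 ≤ m → m ≤ ⌈ ∣ r ∣ /2⌉ → ConditionC r γ m)
    × (r < + 0 → ¬ (+ 2 ∣ r) → ∀ m → 1 ≤ m → ConditionD r γ m) )
theorem1p1 K char0 d a γ =
  -- Integer divisibility unfolds to divisibility of absolute values, so `DegreeConditions` is
  -- definitionally the conclusion.
  Criteria.fixed⇔conditions K char0 (- (a + + d)) γ ⇔-∘ Expansion.functional⇔fixed (scalarRing K) d a γ
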